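{- Any quantum algorithm that solves the Longest Lyndon Substring problem on strings of length $n$ (i.e. outputs the maximum $\ell$ such that $s[i..i+\ell)$ is a Lyndon word for some $i\in[1..n-\ell+1]$) requires $\Omega(\sqrt n)$ quantum queries.
   Context: Strings are 1-indexed sequences over a totally ordered (integer) alphabet; $s[i..j)=s[i]\cdots s[j-1]$. $\prec$ is the lexicographic order: $s\prec t$ if $s$ is a proper prefix of $t$, or at the first position where they differ $s$ has the smaller character. A nonempty string $w$ is a Lyndon word if $w\prec v$ for every nonempty proper suffix $v$ of $w$. Quantum query model: the input string $s$ is accessed through a unitary oracle $O_s:|i,b\rangle\mapsto|i,b\oplus s[i]\rangle$ ($\oplus$ is XOR of binary encodings of characters), which can be queried in superposition; between queries the algorithm may apply arbitrary unitaries independent of the input; it must output the correct answer with probability at least $2/3$. Query complexity is the number of oracle calls. -}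

module Defs where

open import Data.Bool using (Bool; true; false; _xor_; if_then_else_)
import Data.Bool.Properties as Bool
open import Data.Fin as Fin using (Fin; toℕ)
import Data.Fin.Properties as Fin
open import Data.Integer using (+_)
open import Data.List as List
  using (List; []; _∷_; _++_; allFin; cartesianProduct; filter; foldr; take; drop)
open import Data.List.Relation.Binary.Lex.Strict using (Lex-<)
open import Data.Nat as ℕ using (ℕ; zero; suc; _∸_)
import Data.Nat.Properties as ℕ
open import Data.Nat.DivMod using (_/_; _%_)
open import Data.Product using (_×_; _,_; ∃-syntax; proj₁; proj₂)
open import Data.Product.Properties using (≡-dec)
open import Data.Rational as ℚ using (ℚ; 0ℚ; 1ℚ; ½; ∣_∣; 1/_)
import Data.Rational.Properties as ℚ
open import Data.Rational.Solver using (module +-*-Solver)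
open import Data.Vec as Vec using (Vec; []; _∷_; lookup; zipWith)
import Data.Vec.Properties as Vec
open import Relation.Binary using (DecidableEquality)
open import Relation.Binary.PropositionalEquality using (_≡_; _≢_; refl; sym; cong; subst)
open import Relation.Nullary using (does)

-- ===== Real numbers: Cauchy sequences of rationals =====

IsCauchy : (ℕ → ℚ) → Set
IsCauchy x = ∀ ε → 0ℚ ℚ.< ε → ∃[ N ] (∀ m n → N ℕ.≤ m → N ℕ.≤ n → ∣ x m ℚ.- x n ∣ ℚ.< ε)

record ℝ : Set where
  constructor mkℝ
  field
    seq    : ℕ → ℚ
    cauchy : IsCauchy seq

open ℝ public

-- Reals are compared with _≈ᴿ_, not with propositional equality.
infix 4 _≈ᴿ_ _≤ᴿ_

_≈ᴿ_ : ℝ → ℝ → Set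
x ≈ᴿ y = ∀ ε → 0ℚ ℚ.< ε → ∃[ N ] (∀ n → N ℕ.≤ n → ∣ seq x n ℚ.- seq y n ∣ ℚ.< ε)

_≤ᴿ_ : ℝ → ℝ → Set
x ≤ᴿ y = ∀ ε → 0ℚ ℚ.< ε → ∃[ N ] (∀ n → N ℕ.≤ n → seq x n ℚ.< seq y n ℚ.+ ε)

-- The Cauchy proofs are irrelevant to _≈ᴿ_ and _≤ᴿ_; they are kept opaque so that
-- normalisation does not unfold them.
private
  abstract
    const-cauchy : ∀ q → IsCauchy (λ _ → q)
    const-cauchy q ε 0<ε = 0 , λ _ _ _ _ →
      subst (ℚ._< ε) (sym (cong ∣_∣ (ℚ.+-inverseʳ q))) 0<ε

    pos½* : ∀ {ε} → 0ℚ ℚ.< ε → 0ℚ ℚ.< ε ℚ.* ½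
    pos½* {ε} 0<ε = ℚ.*-monoˡ-<-pos ½ 0<ε

    halves : ∀ ε → ε ℚ.* ½ ℚ.+ ε ℚ.* ½ ≡ ε
    halves ε = begin
      ε ℚ.* ½ ℚ.+ ε ℚ.* ½ ≡⟨ ℚ.*-distribˡ-+ ε ½ ½ ⟨
      ε ℚ.* 1ℚ            ≡⟨ ℚ.*-identityʳ ε ⟩
      ε                   ∎
      where open Relation.Binary.PropositionalEquality.≡-Reasoning

    +-cauchy : ∀ x y → IsCauchy x → IsCauchy y → IsCauchy (λ n → x n ℚ.+ y n)
    +-cauchy x y cx cy ε 0<ε
      with cx (ε ℚ.* ½) (pos½* 0<ε) | cy (ε ℚ.* ½) (pos½* 0<ε)
    ... | M , hx | N , hy = M ℕ.⊔ N , λ m n m≥ n≥ → begin-strict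
        ∣ (x m ℚ.+ y m) ℚ.- (x n ℚ.+ y n) ∣
          ≡⟨ cong ∣_∣ (solve 4 (λ a b c d → (a :+ b) :- (c :+ d) := (a :- c) :+ (b :- d))
                         refl (x m) (y m) (x n) (y n)) ⟩
        ∣ (x m ℚ.- x n) ℚ.+ (y m ℚ.- y n) ∣
          ≤⟨ ℚ.∣p+q∣≤∣p∣+∣q∣ (x m ℚ.- x n) (y m ℚ.- y n) ⟩
        ∣ x m ℚ.- x n ∣ ℚ.+ ∣ y m ℚ.- y n ∣
          <⟨ ℚ.+-mono-< (hx m n (ℕ.m⊔n≤o⇒m≤o M N m≥) (ℕ.m⊔n≤o⇒m≤o M N n≥))
                        (hy m n (ℕ.m⊔n≤o⇒n≤o M N m≥) (ℕ.m⊔n≤o⇒n≤o M N n≥)) ⟩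
        ε ℚ.* ½ ℚ.+ ε ℚ.* ½
          ≡⟨ halves ε ⟩
        ε ∎
      where
      open ℚ.≤-Reasoning
      open +-*-Solver

    -‿cauchy : ∀ x → IsCauchy x → IsCauchy (λ n → ℚ.- x n)
    -‿cauchy x cx ε 0<ε with cx ε 0<ε
    ... | N , hx = N , λ m n m≥ n≥ → begin-strict
        ∣ ℚ.- x m ℚ.- ℚ.- x n ∣
          ≡⟨ cong ∣_∣ (solve 2 (λ a b → (:- a) :- (:- b) := :- (a :- b)) refl (x m) (x n)) ⟩
        ∣ ℚ.- (x m ℚ.- x n) ∣
          ≡⟨ ℚ.∣-p∣≡∣p∣ (x m ℚ.- x n) ⟩
        ∣ x m ℚ.- x n ∣
          <⟨ hx m n m≥ n≥ ⟩
        ε ∎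
      where
      open ℚ.≤-Reasoning
      open +-*-Solver

    0<1 : 0ℚ ℚ.< 1ℚ
    0<1 = ℚ.positive⁻¹ 1ℚ

    eventuallyBounded : ∀ x → IsCauchy x →
      ∃[ N ] ∃[ B ] (0ℚ ℚ.< B × (∀ n → N ℕ.≤ n → ∣ x n ∣ ℚ.≤ B))
    eventuallyBounded x cx with cx 1ℚ 0<1
    ... | N , hx = N , 1ℚ ℚ.+ ∣ x N ∣ , ℚ.+-mono-<-≤ 0<1 (ℚ.0≤∣p∣ (x N)) , λ n n≥ → begin
        ∣ x n ∣
          ≡⟨ cong ∣_∣ (solve 2 (λ a b → a := (a :- b) :+ b) refl (x n) (x N)) ⟩
        ∣ (x n ℚ.- x N) ℚ.+ x N ∣
          ≤⟨ ℚ.∣p+q∣≤∣p∣+∣q∣ (x n ℚ.- x N) (x N) ⟩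
        ∣ x n ℚ.- x N ∣ ℚ.+ ∣ x N ∣
          <⟨ ℚ.+-monoˡ-< ∣ x N ∣ (hx n N n≥ ℕ.≤-refl) ⟩
        1ℚ ℚ.+ ∣ x N ∣ ∎
      where
      open ℚ.≤-Reasoning
      open +-*-Solver

    *-difference : ∀ a b c d → a ℚ.* b ℚ.- c ℚ.* d ≡ a ℚ.* (b ℚ.- d) ℚ.+ d ℚ.* (a ℚ.- c)
    *-difference = solve 4 (λ a b c d → a :* b :- c :* d := a :* (b :- d) :+ d :* (a :- c)) refl
      where open +-*-Solver

    0<* : ∀ {p q} → 0ℚ ℚ.< p → 0ℚ ℚ.< q → 0ℚ ℚ.< p ℚ.* q
    0<* {p} {q} 0<p 0<q =
      ℚ.positive⁻¹ (p ℚ.* q) {{ℚ.pos*pos⇒pos p {{ℚ.positive 0<p}} q {{ℚ.positive 0<q}}}}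

    reciprocal : ∀ q → 0ℚ ℚ.< q → ∃[ r ] (0ℚ ℚ.< r × q ℚ.* r ≡ 1ℚ)
    reciprocal q 0<q = 1/ q , ℚ.positive⁻¹ (1/ q) {{ℚ.1/pos⇒pos q}} , ℚ.*-inverseʳ q
      where
      instance
        q>0 : ℚ.Positive q
        q>0 = ℚ.positive 0<q
        q≢0 : ℚ.NonZero q
        q≢0 = ℚ.pos⇒nonZero q

    share : ∀ B C → 0ℚ ℚ.< B → 0ℚ ℚ.< C → ∀ ε → 0ℚ ℚ.< ε →
      ∃[ δ ] (0ℚ ℚ.< δ × B ℚ.* δ ℚ.+ C ℚ.* δ ≡ ε)
    share B C 0<B 0<C ε 0<ε with reciprocal (B ℚ.+ C) (ℚ.+-mono-< 0<B 0<C)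
    ... | r , 0<r , inv = r ℚ.* ε , 0<* 0<r 0<ε , (begin
        B ℚ.* (r ℚ.* ε) ℚ.+ C ℚ.* (r ℚ.* ε) ≡⟨ ℚ.*-distribʳ-+ (r ℚ.* ε) B C ⟨
        (B ℚ.+ C) ℚ.* (r ℚ.* ε)             ≡⟨ ℚ.*-assoc (B ℚ.+ C) r ε ⟨
        (B ℚ.+ C) ℚ.* r ℚ.* ε               ≡⟨ cong (ℚ._* ε) inv ⟩
        1ℚ ℚ.* ε                            ≡⟨ ℚ.*-identityˡ ε ⟩
        ε                                   ∎)
      where open Relation.Binary.PropositionalEquality.≡-Reasoning

    product-< : ∀ {B C δ} a b c d → 0ℚ ℚ.< B → 0ℚ ℚ.< C →
      ∣ a ∣ ℚ.≤ B → ∣ d ∣ ℚ.≤ C → ∣ b ℚ.- d ∣ ℚ.< δ → ∣ a ℚ.- c ∣ ℚ.< δ →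
      ∣ a ℚ.* b ℚ.- c ℚ.* d ∣ ℚ.< B ℚ.* δ ℚ.+ C ℚ.* δ
    product-< {B} {C} {δ} a b c d 0<B 0<C a≤B d≤C b-d<δ a-c<δ = begin-strict
      ∣ a ℚ.* b ℚ.- c ℚ.* d ∣
        ≡⟨ cong ∣_∣ (*-difference a b c d) ⟩
      ∣ a ℚ.* (b ℚ.- d) ℚ.+ d ℚ.* (a ℚ.- c) ∣
        ≤⟨ ℚ.∣p+q∣≤∣p∣+∣q∣ (a ℚ.* (b ℚ.- d)) (d ℚ.* (a ℚ.- c)) ⟩
      ∣ a ℚ.* (b ℚ.- d) ∣ ℚ.+ ∣ d ℚ.* (a ℚ.- c) ∣
        <⟨ ℚ.+-mono-< (part a (b ℚ.- d) 0<B a≤B b-d<δ) (part d (a ℚ.- c) 0<C d≤C a-c<δ) ⟩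
      B ℚ.* δ ℚ.+ C ℚ.* δ ∎
      where
      open ℚ.≤-Reasoning
      part : ∀ {D} p q → 0ℚ ℚ.< D → ∣ p ∣ ℚ.≤ D → ∣ q ∣ ℚ.< δ → ∣ p ℚ.* q ∣ ℚ.< D ℚ.* δ
      part {D} p q 0<D p≤D q<δ = begin-strict
        ∣ p ℚ.* q ∣     ≡⟨ ℚ.∣p*q∣≡∣p∣*∣q∣ p q ⟩
        ∣ p ∣ ℚ.* ∣ q ∣ ≤⟨ ℚ.*-monoʳ-≤-nonNeg ∣ q ∣ {{ℚ.nonNegative (ℚ.0≤∣p∣ q)}} p≤D ⟩
        D ℚ.* ∣ q ∣     <⟨ ℚ.*-monoʳ-<-pos D {{ℚ.positive 0<D}} q<δ ⟩
        D ℚ.* δ         ∎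

    *-cauchy : ∀ x y → IsCauchy x → IsCauchy y → IsCauchy (λ n → x n ℚ.* y n)
    *-cauchy x y cx cy ε 0<ε = bounds (eventuallyBounded x cx) (eventuallyBounded y cy)
      where
      Goal : Set
      Goal = ∃[ N ] (∀ m n → N ℕ.≤ m → N ℕ.≤ n → ∣ x m ℚ.* y m ℚ.- x n ℚ.* y n ∣ ℚ.< ε)

      EventuallyBounded : (ℕ → ℚ) → Set
      EventuallyBounded z = ∃[ N ] ∃[ B ] (0ℚ ℚ.< B × (∀ n → N ℕ.≤ n → ∣ z n ∣ ℚ.≤ B))

      CloseTo : ℚ → (ℕ → ℚ) → Set
      CloseTo δ z = ∃[ N ] (∀ m n → N ℕ.≤ m → N ℕ.≤ n → ∣ z m ℚ.- z n ∣ ℚ.< δ)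

      bounds : EventuallyBounded x → EventuallyBounded y → Goal
      bounds (K , B , 0<B , bx) (L , C , 0<C , by) = shares (share B C 0<B 0<C ε 0<ε)
        where
        close : ∀ δ → B ℚ.* δ ℚ.+ C ℚ.* δ ≡ ε → CloseTo δ x → CloseTo δ y → Goal
        close δ eq (M , hx) (N , hy) = (K ℕ.⊔ M) ℕ.⊔ (L ℕ.⊔ N) , λ m n m≥ n≥ →
          let m≥₁ = ℕ.m⊔n≤o⇒m≤o (K ℕ.⊔ M) (L ℕ.⊔ N) m≥
              m≥₂ = ℕ.m⊔n≤o⇒n≤o (K ℕ.⊔ M) (L ℕ.⊔ N) m≥
              n≥₁ = ℕ.m⊔n≤o⇒m≤o (K ℕ.⊔ M) (L ℕ.⊔ N) n≥
              n≥₂ = ℕ.m⊔n≤o⇒n≤o (K ℕ.⊔ M) (L ℕ.⊔ N) n≥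
          in subst (∣ x m ℚ.* y m ℚ.- x n ℚ.* y n ∣ ℚ.<_) eq
               (product-< (x m) (y m) (x n) (y n) 0<B 0<C
                 (bx m (ℕ.m⊔n≤o⇒m≤o K M m≥₁)) (by n (ℕ.m⊔n≤o⇒m≤o L N n≥₂))
                 (hy m n (ℕ.m⊔n≤o⇒n≤o L N m≥₂) (ℕ.m⊔n≤o⇒n≤o L N n≥₂))
                 (hx m n (ℕ.m⊔n≤o⇒n≤o K M m≥₁) (ℕ.m⊔n≤o⇒n≤o K M n≥₁)))

        shares : ∃[ δ ] (0ℚ ℚ.< δ × B ℚ.* δ ℚ.+ C ℚ.* δ ≡ ε) → Goal
        shares (δ , 0<δ , eq) = close δ eq (cx δ 0<δ) (cy δ 0<δ)

fromℚ : ℚ → ℝ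
fromℚ q = mkℝ (λ _ → q) (const-cauchy q)

0ᴿ 1ᴿ : ℝ
0ᴿ = fromℚ 0ℚ
1ᴿ = fromℚ 1ℚ

infixl 6 _+ᴿ_ _-ᴿ_
infixl 7 _*ᴿ_
infix  8 -ᴿ_

-ᴿ_ : ℝ → ℝ
-ᴿ x = mkℝ (λ n → ℚ.- seq x n) (-‿cauchy (seq x) (cauchy x))

_+ᴿ_ _-ᴿ_ _*ᴿ_ : ℝ → ℝ → ℝ
x +ᴿ y = mkℝ (λ n → seq x n ℚ.+ seq y n) (+-cauchy (seq x) (seq y) (cauchy x) (cauchy y))
x *ᴿ y = mkℝ (λ n → seq x n ℚ.* seq y n) (*-cauchy (seq x) (seq y) (cauchy x) (cauchy y))
x -ᴿ y = x +ᴿ (-ᴿ y)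

-- ===== Complex numbers =====

record ℂ : Set where
  constructor _+i_
  field
    re im : ℝ

open ℂ public

infix  4 _≈ᶜ_
infixl 6 _+ᶜ_
infixl 7 _*ᶜ_

_≈ᶜ_ : ℂ → ℂ → Set
w ≈ᶜ z = re w ≈ᴿ re z × im w ≈ᴿ im z

0ᶜ 1ᶜ : ℂ
0ᶜ = 0ᴿ +i 0ᴿ
1ᶜ = 1ᴿ +i 0ᴿ

_+ᶜ_ _*ᶜ_ : ℂ → ℂ → ℂ
w +ᶜ z = (re w +ᴿ re z) +i (im w +ᴿ im z)
w *ᶜ z = (re w *ᴿ re z -ᴿ im w *ᴿ im z) +i (re w *ᴿ im z +ᴿ im w *ᴿ re z)

conj : ℂ → ℂ
conj z = re z +i (-ᴿ im z)

∣_∣² : ℂ → ℝ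
∣ z ∣² = re z *ᴿ re z +ᴿ im z *ᴿ im z

∑ᴿ : {A : Set} → List A → (A → ℝ) → ℝ
∑ᴿ xs f = foldr (λ x acc → f x +ᴿ acc) 0ᴿ xs

∑ᶜ : {A : Set} → List A → (A → ℂ) → ℂ
∑ᶜ xs f = foldr (λ x acc → f x +ᶜ acc) 0ᶜ xs

-- ===== Strings and Lyndon words =====

-- Strings of length n over the integer alphabet {0, …, σ-1}.
Str : ℕ → ℕ → Set
Str σ n = Vec (Fin σ) n

module _ {σ : ℕ} where

  infix 4 _≺_

  _≺_ : List (Fin σ) → List (Fin σ) → Set
  _≺_ = Lex-< _≡_ Fin._<_

  IsLyndon : List (Fin σ) → Set
  IsLyndon w = w ≢ [] × (∀ u v → u ≢ [] → v ≢ [] → w ≡ u ++ v → w ≺ v)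

  -- s[i..j), positions being counted from 1.
  substring : ∀ {n} → Str σ n → ℕ → ℕ → List (Fin σ)
  substring s i j = take (j ∸ i) (drop (i ∸ 1) (Vec.toList s))

  -- The bounds say i ∈ [1..n-ℓ+1], without truncated subtraction.
  HasLyndonSubstring : ∀ {n} → Str σ n → ℕ → Set
  HasLyndonSubstring {n} s ℓ =
    ∃[ i ] (1 ℕ.≤ i × i ℕ.+ ℓ ℕ.≤ n ℕ.+ 1 × IsLyndon (substring s i (i ℕ.+ ℓ)))

  IsLongestLyndon : ∀ {n} → Str σ n → ℕ → Set
  IsLongestLyndon s ℓ =
    HasLyndonSubstring s ℓ × (∀ ℓ′ → HasLyndonSubstring s ℓ′ → ℓ′ ℕ.≤ ℓ)

-- ===== Quantum query algorithms =====

-- Binary encoding on b bits, least significant bit first;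
-- faithful on the numbers below 2 ^ b.
binary : (b : ℕ) → ℕ → Vec Bool b
binary zero    k = []
binary (suc b) k = does (k % 2 ℕ.≟ 1) ∷ binary b (k / 2)

_⊕_ : ∀ {b} → Vec Bool b → Vec Bool b → Vec Bool b
_⊕_ = zipWith _xor_

bitStrings : (b : ℕ) → List (Vec Bool b)
bitStrings zero    = [] ∷ []
bitStrings (suc b) = List.map (false ∷_) (bitStrings b) ++ List.map (true ∷_) (bitStrings b)

-- Labels of the computational basis |i, c, w⟩: index register, b-bit character
-- register, and a workspace of dimension W on which the oracle acts trivially.
-- Position i ∈ [1..n] is represented by the element of Fin n with value i - 1.
Basis : (n b W : ℕ) → Set
Basis n b W = Fin n × Vec Bool b × Fin W

module _ {n b W : ℕ} where

  basis : List (Basis n b W)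
  basis = cartesianProduct (allFin n) (cartesianProduct (bitStrings b) (allFin W))

  _≟ᴮ_ : DecidableEquality (Basis n b W)
  _≟ᴮ_ = ≡-dec Fin._≟_ (≡-dec (Vec.≡-dec Bool._≟_) Fin._≟_)

  State Operator : Set
  State    = Basis n b W → ℂ
  Operator = Basis n b W → Basis n b W → ℂ

  ket : Basis n b W → State
  ket y x = if does (x ≟ᴮ y) then 1ᶜ else 0ᶜ

  identity : Operator
  identity x y = ket y x

  infixr 8 _·_
  infixl 9 _∘ᴼ_

  _·_ : Operator → State → State
  (M · ψ) x = ∑ᶜ basis (λ y → M x y *ᶜ ψ y)

  _∘ᴼ_ : Operator → Operator → Operator
  (M ∘ᴼ N) x y = ∑ᶜ basis (λ z → M x z *ᶜ N z y)

  _† : Operator → Operator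
  (M †) x y = conj (M y x)

  IsUnitary : Operator → Set
  IsUnitary M = (∀ x y → ((M †) ∘ᴼ M) x y ≈ᶜ identity x y)
              × (∀ x y → (M ∘ᴼ (M †)) x y ≈ᶜ identity x y)

  -- O_s : |i, c, w⟩ ↦ |i, c ⊕ s[i], w⟩, as a matrix; its column at y is the image of |y⟩.
  oracle : ∀ {σ} → Str σ n → Operator
  oracle s x (i , c , w) = ket (i , c ⊕ binary b (toℕ (lookup s i)) , w) x

record Unitary (n b W : ℕ) : Set where
  field
    operator  : Operator {n} {b} {W}
    isUnitary : IsUnitary operator

open Unitary public

-- An algorithm making T queries: prepare a fixed basis state, apply U₀, then T times
-- an oracle call followed by an input-independent unitary; finally measure in the
-- computational basis and output a number determined by the outcome.
record Algorithm (n b T : ℕ) : Set where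
  field
    workDim  : ℕ
    initial  : Basis n b workDim
    U₀       : Unitary n b workDim
    U        : Vec (Unitary n b workDim) T
    output   : Basis n b workDim → ℕ

open Algorithm public

module _ {n b T σ : ℕ} (A : Algorithm n b T) (s : Str σ n) where

  finalState : State {n} {b} {workDim A}
  finalState = Vec.foldl′ (λ ψ V → operator V · oracle s · ψ)
                          (operator (U₀ A) · ket (initial A)) (U A)

  probability : ℕ → ℝ
  probability ℓ =
    ∑ᴿ (filter (λ x → output A x ℕ.≟ ℓ) basis) (λ x → ∣ finalState x ∣²)

SolvesLongestLyndon : ∀ {n b T} → (σ : ℕ) → Algorithm n b T → Set
SolvesLongestLyndon {n} σ A =
  ∀ (s : Str σ n) ℓ → IsLongestLyndon s ℓ → fromℚ (+ 2 ℚ./ 3) ≤ᴿ probability A s ℓ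

{-# OPTIONS --safe #-}

-- The hybrid argument of Bennett, Bernstein, Brassard and Vazirani, applied to the string 0ⁿ
-- and the strings 0ᵏ 1 0ⁿ⁻ᵏ⁻¹ with k ≥ 1. Their longest Lyndon substrings have lengths 1 and
-- k + 1, since a Lyndon word of length at least two does not end in the least character. An
-- algorithm that succeeds with probability 2/3 must therefore bring the final states of these
-- runs to a constant distance. In one step the runs on 0ⁿ and on the k-th string drift apart by
-- at most twice the amplitude that the run on 0ⁿ has at query position k; the squares of
-- these amplitudes add up to 1 over k, so the squared final distances add up to O(T²) over
-- k, whereas each of them is at least a constant.

module Submission where

open import Defs
open import Algebra.Bundles using (CommutativeRing)
import Algebra.Properties.Ring as RingProperties
open import Data.Bool using (Bool; true; false; _xor_; if_then_else_)
import Data.Bool.Properties as Bool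
open import Data.Empty using (⊥; ⊥-elim)
open import Data.Fin as Fin using (Fin; zero; suc; toℕ; fromℕ<)
import Data.Fin.Properties as Fin
open import Data.Integer using (+_)
open import Data.List as List
  using (List; []; _∷_; _++_; allFin; filter; foldr; length; take; drop)
open import Data.List.Membership.Propositional using (_∈_)
open import Data.List.Membership.Propositional.Properties
  using (∈-++⁺ˡ; ∈-++⁺ʳ; ∈-map⁺; ∈-map⁻; ∈-allFin; ∈-cartesianProduct⁺)
import Data.List.Properties as List
open import Data.List.Relation.Binary.Lex.Strict using (base; this; next; <-transitive)
open import Data.List.Relation.Unary.All as All using (All; []; _∷_)
open import Data.List.Relation.Unary.AllPairs using ([]; _∷_)
open import Data.List.Relation.Unary.Any using (here; there)
open import Data.List.Relation.Unary.Unique.Propositional using (Unique)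
import Data.List.Relation.Unary.Unique.Propositional.Properties as Unique
open import Data.Nat as ℕ using (ℕ; zero; suc; z≤n; s≤s)
import Data.Nat.Properties as ℕ
import Data.Nat.Solver as ℕ
open import Data.Product using (_×_; _,_; ∃-syntax; proj₁; proj₂)
open import Data.Rational as ℚ using (ℚ; 0ℚ; 1ℚ; ½; ∣_∣; 1/_)
import Data.Rational.Properties as ℚ
open import Data.Rational.Solver using (module +-*-Solver)
open import Data.Sum using (inj₁; inj₂)
open import Data.Vec as Vec using (Vec; []; _∷_; lookup; replicate; _[_]≔_)
import Data.Vec.Properties as Vec
open import Function using (mk⇔)
open import Level using (0ℓ)
open import Relation.Binary using (DecidableEquality)
open import Relation.Binary.Bundles using (Preorder)
open import Relation.Binary.PropositionalEquality as ≡ using (_≡_; _≢_)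
open import Relation.Binary.Structures using (IsEquivalence)
open import Relation.Nullary using (¬_; Dec; yes; no; does; contradiction)
open import Relation.Nullary.Decidable using (dec-false; dec-true; does-⇔)

-- Sums over lists in a commutative ring

-- The reals at hand are Cauchy sequences of rationals and come without square roots, so no norm is
-- ever formed: everything is said about squared norms, and their triangle inequality must carry
-- weights. The form q∣u + v∣² ≤ (1 + q)∣u∣² + q(1 + q)∣v∣² needs rational weights only and no
-- division, and because its two sides differ by the square ∣u - qv∣², it already holds term by term
-- on the approximating rationals. Three choices of `q` are made: 1 for the effect of a single
-- query, 2 for comparing outcome probabilities, and t for the t-th step of a run. The last one has
-- to grow: with a fixed weight each step would multiply the earlier error by the constant 1 + 1/q,
-- and the bound would become exponential in T. With weight t the factors (t + 1)/t telescope, and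
-- the total stays linear in T times the sum of the errors of the single steps.

module ListSum {c ℓ} (R : CommutativeRing c ℓ) where
  open CommutativeRing R hiding (zero)
  open RingProperties ring using (-‿+-comm; -0#≈0#)
  open import Relation.Binary.Reasoning.Setoid setoid
  open import Algebra.Properties.CommutativeSemigroup +-commutativeSemigroup using (interchange)
  open import Algebra.Properties.CommutativeSemigroup *-commutativeSemigroup
    using () renaming (interchange to *-interchange)

  ∑ : {A : Set} → List A → (A → Carrier) → Carrier
  ∑ xs f = foldr (λ x acc → f x + acc) 0# xs

  module _ {A : Set} where

    ∑-cong : ∀ xs {f g : A → Carrier} → (∀ x → f x ≈ g x) → ∑ xs f ≈ ∑ xs g
    ∑-cong []       f≈g = refl
    ∑-cong (x ∷ xs) f≈g = +-cong (f≈g x) (∑-cong xs f≈g)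

    ∑-0# : ∀ (xs : List A) → ∑ xs (λ _ → 0#) ≈ 0#
    ∑-0# []       = refl
    ∑-0# (x ∷ xs) = trans (+-identityˡ _) (∑-0# xs)

    ∑-+ : ∀ xs (f g : A → Carrier) → ∑ xs (λ x → f x + g x) ≈ ∑ xs f + ∑ xs g
    ∑-+ []       f g = sym (+-identityˡ 0#)
    ∑-+ (x ∷ xs) f g = trans (+-congˡ (∑-+ xs f g)) (interchange _ _ _ _)

    ∑-neg : ∀ xs (f : A → Carrier) → ∑ xs (λ x → - f x) ≈ - ∑ xs f
    ∑-neg []       f = sym -0#≈0#
    ∑-neg (x ∷ xs) f = trans (+-congˡ (∑-neg xs f)) (-‿+-comm _ _)

    *-distribˡ-∑ : ∀ a xs (f : A → Carrier) → a * ∑ xs f ≈ ∑ xs (λ x → a * f x)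
    *-distribˡ-∑ a []       f = zeroʳ a
    *-distribˡ-∑ a (x ∷ xs) f = trans (distribˡ a _ _) (+-congˡ (*-distribˡ-∑ a xs f))

    *-distribʳ-∑ : ∀ a xs (f : A → Carrier) → ∑ xs f * a ≈ ∑ xs (λ x → f x * a)
    *-distribʳ-∑ a []       f = zeroˡ a
    *-distribʳ-∑ a (x ∷ xs) f = trans (distribʳ a _ _) (+-congˡ (*-distribʳ-∑ a xs f))

    ∑-filter : ∀ {P : A → Set} (P? : ∀ x → Dec (P x)) xs (f : A → Carrier) →
               ∑ (filter P? xs) f ≈ ∑ xs (λ x → if does (P? x) then f x else 0#)
    ∑-filter P? []       f = refl
    ∑-filter P? (x ∷ xs) f with does (P? x)
    ... | true  = +-congˡ (∑-filter P? xs f)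
    ... | false = trans (∑-filter P? xs f) (sym (+-identityˡ _))

  ∑-swap : ∀ {A B : Set} xs ys (f : A → B → Carrier) →
           ∑ xs (λ x → ∑ ys (f x)) ≈ ∑ ys (λ y → ∑ xs (λ x → f x y))
  ∑-swap []       ys f = sym (∑-0# ys)
  ∑-swap (x ∷ xs) ys f = trans (+-congˡ (∑-swap xs ys f)) (sym (∑-+ ys _ _))

  ∑-*-∑ : ∀ {A B : Set} xs ys (f : A → Carrier) (g : B → Carrier) →
          ∑ xs f * ∑ ys g ≈ ∑ xs (λ x → ∑ ys (λ y → f x * g y))
  ∑-*-∑ xs ys f g = trans (*-distribʳ-∑ _ xs f) (∑-cong xs λ x → *-distribˡ-∑ (f x) ys g)

  module _ {A : Set} (_≟_ : DecidableEquality A) where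

    δ : A → A → Carrier
    δ x y = if does (x ≟ y) then 1# else 0#

    δ-≡ : ∀ {x y} → x ≡ y → δ x y ≈ 1#
    δ-≡ {x} {y} x≡y rewrite dec-true (x ≟ y) x≡y = refl

    δ-≢ : ∀ {x y} → x ≢ y → δ x y ≈ 0#
    δ-≢ {x} {y} x≢y rewrite dec-false (x ≟ y) x≢y = refl

    δ-sym : ∀ x y → δ x y ≡ δ y x
    δ-sym x y = ≡.cong (if_then 1# else 0#) (does-⇔ (mk⇔ ≡.sym ≡.sym) (x ≟ y) (y ≟ x))

    ∑-δ-∉ : ∀ {xs} y (f : A → Carrier) → All (y ≢_) xs → ∑ xs (λ x → δ y x * f x) ≈ 0#
    ∑-δ-∉ y f []               = refl
    ∑-δ-∉ y f (y≢x ∷ y≢xs) =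
      trans (+-cong (trans (*-congʳ (δ-≢ y≢x)) (zeroˡ _)) (∑-δ-∉ y f y≢xs)) (+-identityˡ 0#)

    ∑-δ : ∀ {xs y} (f : A → Carrier) → Unique xs → y ∈ xs → ∑ xs (λ x → δ y x * f x) ≈ f y
    ∑-δ {x ∷ xs} {y} f (x≢xs ∷ _) (here ≡.refl) =
      trans (+-cong (trans (*-congʳ (δ-≡ ≡.refl)) (*-identityˡ _)) (∑-δ-∉ y f x≢xs)) (+-identityʳ _)
    ∑-δ {x ∷ xs} {y} f (x≢xs ∷ uniq) (there y∈xs) =
      trans (+-cong (trans (*-congʳ (δ-≢ y≢x)) (zeroˡ _)) (∑-δ f uniq y∈xs)) (+-identityˡ _)
      where
      y≢x : y ≢ x
      y≢x ≡.refl = All.lookup x≢xs y∈xs ≡.refl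

    module _ {π : A → A} (involutive : ∀ x → π (π x) ≡ x) where

      δ-involution : ∀ x y → δ x (π y) ≡ δ (π x) y
      δ-involution x y = ≡.cong (if_then 1# else 0#)
        (does-⇔ (mk⇔ (λ { ≡.refl → involutive y }) (λ { ≡.refl → ≡.sym (involutive x) }))
                (x ≟ π y) (π x ≟ y))

      -- Writing each `f (π x)` as a sum against `δ (π x)` makes the reindexing an exchange of two
      -- sums, since `δ (π x) y` equals `δ (π y) x` for an involution. No permutation of the list
      -- has to be constructed.
      ∑-involution : ∀ {xs} (f : A → Carrier) → Unique xs → (∀ x → x ∈ xs) →
                     ∑ xs (λ x → f (π x)) ≈ ∑ xs f
      ∑-involution {xs} f uniq complete = begin
        ∑ xs (λ x → f (π x))                      ≈⟨ ∑-cong xs (λ x → ∑-δ f uniq (complete (π x))) ⟨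
        ∑ xs (λ x → ∑ xs (λ y → δ (π x) y * f y)) ≈⟨ ∑-swap xs xs _ ⟩
        ∑ xs (λ y → ∑ xs (λ x → δ (π x) y * f y)) ≈⟨ ∑-cong xs (λ y → ∑-cong xs (λ x →
                                                       *-congʳ (reflexive (flip x y)))) ⟩
        ∑ xs (λ y → ∑ xs (λ x → δ (π y) x * f y)) ≈⟨ ∑-cong xs (λ y →
                                                       ∑-δ (λ _ → f y) uniq (complete (π y))) ⟩
        ∑ xs f                                    ∎
        where
        flip : ∀ x y → δ (π x) y ≡ δ (π y) x
        flip x y = ≡.trans (≡.sym (δ-involution x y)) (δ-sym x (π y))

  module _ (conj : Carrier → Carrier) (conj-0# : conj 0# ≈ 0#)
           (conj-+ : ∀ x y → conj (x + y) ≈ conj x + conj y)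
           (conj-* : ∀ x y → conj (x * y) ≈ conj x * conj y) where

    conj-∑ : ∀ {A : Set} xs (f : A → Carrier) → conj (∑ xs f) ≈ ∑ xs (λ x → conj (f x))
    conj-∑ []       f = conj-0#
    conj-∑ (x ∷ xs) f = trans (conj-+ _ _) (+-congˡ (conj-∑ xs f))

    module _ {A : Set} (_≟_ : DecidableEquality A) {xs : List A} (uniq : Unique xs)
             (complete : ∀ x → x ∈ xs) where

      -- The hypothesis is the entry (y, z) of M†M = 1. Expanding both sums and moving the sum over
      -- rows inwards brings out exactly these entries, and `δ` then collapses the double sum to its
      -- diagonal.
      isometry : ∀ (M : A → A → Carrier) →
                 (∀ y z → ∑ xs (λ x → conj (M x y) * M x z) ≈ δ _≟_ y z) → ∀ (ψ : A → Carrier) →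
                 ∑ xs (λ x → conj (∑ xs (λ y → M x y * ψ y)) * ∑ xs (λ z → M x z * ψ z))
                 ≈ ∑ xs (λ y → conj (ψ y) * ψ y)
      isometry M orthonormal ψ = begin
        ∑ xs (λ x → conj (∑ xs (λ y → M x y * ψ y)) * ∑ xs (λ z → M x z * ψ z))
          ≈⟨ ∑-cong xs (λ x → *-congʳ (conj-∑ xs _)) ⟩
        ∑ xs (λ x → ∑ xs (λ y → conj (M x y * ψ y)) * ∑ xs (λ z → M x z * ψ z))
          ≈⟨ ∑-cong xs (λ x → ∑-*-∑ xs xs _ _) ⟩
        ∑ xs (λ x → ∑ xs (λ y → ∑ xs (λ z → conj (M x y * ψ y) * (M x z * ψ z))))
          ≈⟨ ∑-cong xs (λ x → ∑-cong xs (λ y → ∑-cong xs (λ z → regroup x y z))) ⟩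
        ∑ xs (λ x → ∑ xs (λ y → ∑ xs (λ z → (conj (M x y) * M x z) * (conj (ψ y) * ψ z))))
          ≈⟨ ∑-swap xs xs _ ⟩
        ∑ xs (λ y → ∑ xs (λ x → ∑ xs (λ z → (conj (M x y) * M x z) * (conj (ψ y) * ψ z))))
          ≈⟨ ∑-cong xs (λ y → ∑-swap xs xs _) ⟩
        ∑ xs (λ y → ∑ xs (λ z → ∑ xs (λ x → (conj (M x y) * M x z) * (conj (ψ y) * ψ z))))
          ≈⟨ ∑-cong xs (λ y → ∑-cong xs (λ z → *-distribʳ-∑ _ xs _)) ⟨
        ∑ xs (λ y → ∑ xs (λ z → ∑ xs (λ x → conj (M x y) * M x z) * (conj (ψ y) * ψ z)))
          ≈⟨ ∑-cong xs (λ y → ∑-cong xs (λ z → *-congʳ (orthonormal y z))) ⟩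
        ∑ xs (λ y → ∑ xs (λ z → δ _≟_ y z * (conj (ψ y) * ψ z)))
          ≈⟨ ∑-cong xs (λ y → ∑-δ _≟_ (λ z → conj (ψ y) * ψ z) uniq (complete y)) ⟩
        ∑ xs (λ y → conj (ψ y) * ψ y)
          ∎
        where
        regroup : ∀ x y z → conj (M x y * ψ y) * (M x z * ψ z)
                            ≈ (conj (M x y) * M x z) * (conj (ψ y) * ψ z)
        regroup x y z = trans (*-congʳ (conj-* _ _)) (*-interchange _ _ _ _)

open ≡ using (refl; cong; cong₂; subst)

-- Lyndon substrings of the hard instances

blank : ∀ {m} n → Str (suc (suc m)) n
blank n = replicate n zero

marked : ∀ {m n} → Fin n → Str (suc (suc m)) n
marked {n = n} k = blank n [ k ]≔ suc zero

lookup-marked : ∀ {m n} (k i : Fin n) → i ≢ k → lookup (marked {m} k) i ≡ lookup (blank {m} n) i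
lookup-marked {n = n} k i i≢k = Vec.lookup∘update′ i≢k (blank n) (suc zero)

module _ {m : ℕ} where

  private
    Char : Set
    Char = Fin (suc (suc m))

  ≺-trans : ∀ {u v w : List Char} → u ≺ v → v ≺ w → u ≺ w
  ≺-trans = <-transitive ≡.isEquivalence ((λ { refl p → p }) , (λ { refl p → p })) Fin.<-trans

  -- The suffix consisting of the final `zero` alone refutes the Lyndon property: no character is
  -- below `zero`, so a word preceding it has to start with `zero` and continue with something below
  -- the empty word.
  ends-zero⇒¬IsLyndon : ∀ (u : List Char) → u ≢ [] → ¬ IsLyndon (u ++ zero ∷ [])
  ends-zero⇒¬IsLyndon []      u≢[] _          = u≢[] refl
  ends-zero⇒¬IsLyndon (c ∷ u) u≢[] (_ , least) with least (c ∷ u) (zero ∷ []) (λ ()) (λ ()) refl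
  ... | next _ u0≺[] = contradiction u0≺[] (¬≺[] (u ++ zero ∷ []))
    where
    ¬≺[] : ∀ (w : List Char) → ¬ (w ≺ [])
    ¬≺[] []      (base ())
    ¬≺[] (x ∷ w) ()

  take-drop-last : ∀ {n} (s : Vec Char n) j ℓ (j+ℓ<n : j ℕ.+ ℓ ℕ.< n) →
    take (suc ℓ) (drop j (Vec.toList s))
      ≡ take ℓ (drop j (Vec.toList s)) ++ lookup s (fromℕ< j+ℓ<n) ∷ []
  take-drop-last (c ∷ s) zero    zero    (s≤s lt) = refl
  take-drop-last (c ∷ s) zero    (suc ℓ) (s≤s lt) = cong (c ∷_) (take-drop-last s zero ℓ lt)
  take-drop-last (c ∷ s) (suc j) ℓ       (s≤s lt) = take-drop-last s j ℓ lt

  take-drop≢[] : ∀ {n} (s : Vec Char n) j ℓ → j ℕ.< n → take (suc ℓ) (drop j (Vec.toList s)) ≢ []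
  take-drop≢[] (c ∷ s) zero    ℓ _        = λ ()
  take-drop≢[] (c ∷ s) (suc j) ℓ (s≤s lt) = take-drop≢[] s j ℓ lt

  -- A Lyndon word with at least two characters does not end with the least character.
  lyndon-length : ∀ {n} (s : Str (suc (suc m)) n) (r : ℕ) → 1 ℕ.≤ r →
    (∀ i → lookup s i ≢ zero → toℕ i ℕ.< r) →
    ∀ ℓ → HasLyndonSubstring s ℓ → ℓ ℕ.≤ r
  lyndon-length s r 1≤r bound zero          _ = z≤n
  lyndon-length s r 1≤r bound (suc zero)    _ = 1≤r
  lyndon-length {n} s r 1≤r bound (suc (suc ℓ)) (suc j , _ , i+ℓ≤n+1 , lyndon) = begin
    suc (suc ℓ)               ≤⟨ ℕ.m≤n+m (suc (suc ℓ)) j ⟩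
    j ℕ.+ suc (suc ℓ)         ≡⟨ ℕ.+-suc j (suc ℓ) ⟩
    suc (j ℕ.+ suc ℓ)         ≡⟨ cong suc (Fin.toℕ-fromℕ< last<n) ⟨
    suc (toℕ (fromℕ< last<n)) ≤⟨ bound (fromℕ< last<n) last≢zero ⟩
    r                         ∎
    where
    open ℕ.≤-Reasoning
    -- Substrings count positions from 1 and `lookup` counts from 0: the word of length
    -- `suc (suc ℓ)` that starts at position `suc j` ends at index `j ℕ.+ suc ℓ`.
    last<n : j ℕ.+ suc ℓ ℕ.< n
    last<n = ℕ.≤-pred (≡.subst₂ ℕ._≤_ (cong suc (ℕ.+-suc j (suc ℓ))) (ℕ.+-comm n 1) i+ℓ≤n+1)
    init : List Char
    init = take (suc ℓ) (drop j (Vec.toList s))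
    substring≡ : substring s (suc j) (suc j ℕ.+ suc (suc ℓ)) ≡ init ++ lookup s (fromℕ< last<n) ∷ []
    substring≡ = ≡.trans (cong (λ l → take l (drop j (Vec.toList s))) (ℕ.m+n∸m≡n j (suc (suc ℓ))))
                       (take-drop-last s j (suc ℓ) last<n)
    last≢zero : lookup s (fromℕ< last<n) ≢ zero
    last≢zero last≡zero = ends-zero⇒¬IsLyndon init
      (take-drop≢[] s j ℓ (ℕ.≤-trans (s≤s (ℕ.m≤m+n j (suc ℓ))) last<n))
      (subst IsLyndon (≡.trans substring≡ (cong (λ c → init ++ c ∷ []) last≡zero)) lyndon)

  zerosOne : ℕ → List Char
  zerosOne zero    = suc zero ∷ []
  zerosOne (suc k) = zero ∷ zerosOne k

  zerosOne-suc-≺ : ∀ k → zerosOne (suc k) ≺ zerosOne k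
  zerosOne-suc-≺ zero    = this (s≤s z≤n)
  zerosOne-suc-≺ (suc k) = next refl (zerosOne-suc-≺ k)

  -- Dropping one leading zero makes the word larger, and every proper nonempty suffix arises by
  -- dropping several of them.
  zerosOne-≺ : ∀ k u v → u ≢ [] → v ≢ [] → zerosOne k ≡ u ++ v → zerosOne k ≺ v
  zerosOne-≺ k       []           v u≢[] _ _    = contradiction refl u≢[]
  zerosOne-≺ zero    (c ∷ [])     v _ v≢[] eq   = contradiction (≡.sym (List.∷-injectiveʳ eq)) v≢[]
  zerosOne-≺ zero    (c ∷ d ∷ u)  v _ v≢[] eq   = contradiction (List.∷-injectiveʳ eq) λ ()
  zerosOne-≺ (suc k) (c ∷ [])     v _ v≢[] refl = zerosOne-suc-≺ k
  zerosOne-≺ (suc k) (c ∷ d ∷ u)  v _ v≢[] eq   =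
    ≺-trans (zerosOne-suc-≺ k) (zerosOne-≺ k (d ∷ u) v (λ ()) v≢[] (List.∷-injectiveʳ eq))

  zerosOne-lyndon : ∀ k → IsLyndon (zerosOne k)
  zerosOne-lyndon k = nonempty k , zerosOne-≺ k
    where
    nonempty : ∀ k → zerosOne k ≢ []
    nonempty zero    ()
    nonempty (suc k) ()

  take-marked : ∀ {n} (k : Fin n) → take (suc (toℕ k)) (Vec.toList (marked {m} k)) ≡ zerosOne (toℕ k)
  take-marked zero    = refl
  take-marked (suc k) = cong (zero ∷_) (take-marked k)

  longest-blank : ∀ n → IsLongestLyndon (blank {m} (suc n)) 1
  longest-blank n =
    (1 , ℕ.≤-refl , s≤s (ℕ.m≤n+m 1 n) , (λ ()) , singleton) ,
    lyndon-length (blank (suc n)) 1 ℕ.≤-refl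
      (λ i ≢zero → contradiction (Vec.lookup-replicate i zero) ≢zero)
    where
    singleton : ∀ u v → u ≢ [] → v ≢ [] → zero ∷ [] ≡ u ++ v → (zero ∷ []) ≺ v
    singleton []          v u≢[] _ _  = contradiction refl u≢[]
    singleton (_ ∷ [])    v _ v≢[] eq = contradiction (≡.sym (List.∷-injectiveʳ eq)) v≢[]
    singleton (_ ∷ _ ∷ _) v _ _ eq    = contradiction (List.∷-injectiveʳ eq) λ ()

  -- The prefix that ends at the mark is Lyndon, and `lyndon-length` forbids anything longer because
  -- index `k` carries the only nonzero character.
  longest-marked : ∀ {n} (k : Fin n) → IsLongestLyndon (marked {m} k) (suc (toℕ k))
  longest-marked {n} k =
    (1 , ℕ.≤-refl , subst (suc (suc (toℕ k)) ℕ.≤_) (ℕ.+-comm 1 n) (s≤s (Fin.toℕ<n k)) ,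
     subst IsLyndon (≡.sym (take-marked k)) (zerosOne-lyndon (toℕ k))) ,
    lyndon-length (marked k) (suc (toℕ k)) (s≤s z≤n) position
    where
    position : ∀ i → lookup (marked k) i ≢ zero → toℕ i ℕ.< suc (toℕ k)
    position i ≢zero with i Fin.≟ k
    ... | yes refl = ℕ.≤-refl
    ... | no i≢k   =
      contradiction (≡.trans (lookup-marked k i i≢k) (Vec.lookup-replicate i zero)) ≢zero

-- Limits of rational sequences

private
  variable
    f g h k : ℕ → ℚ

Eventually : (ℕ → Set) → Set
Eventually P = ∃[ N ] (∀ n → N ℕ.≤ n → P n)

-- These are what `_≈ᴿ_` and `_≤ᴿ_` unfold to, stated for bare sequences so that limit arguments
-- need not carry Cauchy proofs along.
_≈ˢ_ _≤ˢ_ : (ℕ → ℚ) → (ℕ → ℚ) → Set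
f ≈ˢ g = ∀ ε → 0ℚ ℚ.< ε → Eventually (λ n → ∣ f n ℚ.- g n ∣ ℚ.< ε)
f ≤ˢ g = ∀ ε → 0ℚ ℚ.< ε → Eventually (λ n → f n ℚ.< g n ℚ.+ ε)

eventually-× : {P Q : ℕ → Set} → Eventually P → Eventually Q → Eventually (λ n → P n × Q n)
eventually-× (M , p) (N , q) = M ℕ.⊔ N , λ n n≥ →
  p n (ℕ.m⊔n≤o⇒m≤o M N n≥) , q n (ℕ.m⊔n≤o⇒n≤o M N n≥)

halve : ∀ {ε} → 0ℚ ℚ.< ε → 0ℚ ℚ.< ε ℚ.* ½
halve = ℚ.*-monoˡ-<-pos ½

half+half : ∀ ε → ε ℚ.* ½ ℚ.+ ε ℚ.* ½ ≡ ε
half+half ε = ≡.trans (≡.sym (ℚ.*-distribˡ-+ ε ½ ½)) (ℚ.*-identityʳ ε)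

scale : ∀ q → 0ℚ ℚ.< q → ∀ ε → 0ℚ ℚ.< ε → ∃[ δ ] (0ℚ ℚ.< δ × q ℚ.* δ ≡ ε)
scale q 0<q ε 0<ε =
  1/ q ℚ.* ε ,
  ℚ.positive⁻¹ (1/ q ℚ.* ε) {{ℚ.pos*pos⇒pos (1/ q) {{ℚ.1/pos⇒pos q}} ε {{ℚ.positive 0<ε}}}} ,
  ≡.trans (≡.sym (ℚ.*-assoc q (1/ q) ε))
          (≡.trans (cong (ℚ._* ε) (ℚ.*-inverseʳ q)) (ℚ.*-identityˡ ε))
  where
  instance
    q>0 : ℚ.Positive q
    q>0 = ℚ.positive 0<q
    q≢0 : ℚ.NonZero q
    q≢0 = ℚ.pos⇒nonZero q

private module ℚ-identities where
  open +-*-Solver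

  swap-sub : ∀ p q → ℚ.- (p ℚ.- q) ≡ q ℚ.- p
  swap-sub = solve 2 (λ p q → :- (p :- q) := q :- p) refl

  neg-sub-neg : ∀ p q → ℚ.- p ℚ.- ℚ.- q ≡ q ℚ.- p
  neg-sub-neg = solve 2 (λ p q → (:- p) :- (:- q) := q :- p) refl

  add-sub : ∀ p q → q ℚ.+ (p ℚ.- q) ≡ p
  add-sub = solve 2 (λ p q → q :+ (p :- q) := p) refl

  sub-trans : ∀ p q r → p ℚ.- r ≡ (p ℚ.- q) ℚ.+ (q ℚ.- r)
  sub-trans = solve 3 (λ p q r → p :- r := (p :- q) :+ (q :- r)) refl

  add-sub-add : ∀ p q r s → (p ℚ.+ r) ℚ.- (q ℚ.+ s) ≡ (p ℚ.- q) ℚ.+ (r ℚ.- s)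
  add-sub-add = solve 4 (λ p q r s → (p :+ r) :- (q :+ s) := (p :- q) :+ (r :- s)) refl

  add-interchange : ∀ p q r s → (p ℚ.+ q) ℚ.+ (r ℚ.+ s) ≡ (p ℚ.+ r) ℚ.+ (q ℚ.+ s)
  add-interchange = solve 4 (λ p q r s → (p :+ q) :+ (r :+ s) := (p :+ r) :+ (q :+ s)) refl

  mul-sub : ∀ p q r → p ℚ.* q ℚ.- p ℚ.* r ≡ p ℚ.* (q ℚ.- r)
  mul-sub = solve 3 (λ p q r → p :* q :- p :* r := p :* (q :- r)) refl

  re-assoc : ∀ a b c d e f →
    (a ℚ.* c ℚ.- b ℚ.* d) ℚ.* e ℚ.- (a ℚ.* d ℚ.+ b ℚ.* c) ℚ.* f
    ≡ a ℚ.* (c ℚ.* e ℚ.- d ℚ.* f) ℚ.- b ℚ.* (c ℚ.* f ℚ.+ d ℚ.* e)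
  re-assoc = solve 6 (λ a b c d e f →
    (a :* c :- b :* d) :* e :- (a :* d :+ b :* c) :* f
    := a :* (c :* e :- d :* f) :- b :* (c :* f :+ d :* e)) refl

  im-assoc : ∀ a b c d e f →
    (a ℚ.* c ℚ.- b ℚ.* d) ℚ.* f ℚ.+ (a ℚ.* d ℚ.+ b ℚ.* c) ℚ.* e
    ≡ a ℚ.* (c ℚ.* f ℚ.+ d ℚ.* e) ℚ.+ b ℚ.* (c ℚ.* e ℚ.- d ℚ.* f)
  im-assoc = solve 6 (λ a b c d e f →
    (a :* c :- b :* d) :* f :+ (a :* d :+ b :* c) :* e
    := a :* (c :* f :+ d :* e) :+ b :* (c :* e :- d :* f)) refl

  re-comm : ∀ a b c d → a ℚ.* c ℚ.- b ℚ.* d ≡ c ℚ.* a ℚ.- d ℚ.* b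
  re-comm = solve 4 (λ a b c d → a :* c :- b :* d := c :* a :- d :* b) refl

  im-comm : ∀ a b c d → a ℚ.* d ℚ.+ b ℚ.* c ≡ c ℚ.* b ℚ.+ d ℚ.* a
  im-comm = solve 4 (λ a b c d → a :* d :+ b :* c := c :* b :+ d :* a) refl

  re-identity : ∀ a b → 1ℚ ℚ.* a ℚ.- 0ℚ ℚ.* b ≡ a
  re-identity = solve 2 (λ a b → con 1ℚ :* a :- con 0ℚ :* b := a) refl

  im-identity : ∀ a b → 1ℚ ℚ.* b ℚ.+ 0ℚ ℚ.* a ≡ b
  im-identity = solve 2 (λ a b → con 1ℚ :* b :+ con 0ℚ :* a := b) refl

  re-distribˡ : ∀ a b c d e f → a ℚ.* (c ℚ.+ e) ℚ.- b ℚ.* (d ℚ.+ f)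
    ≡ (a ℚ.* c ℚ.- b ℚ.* d) ℚ.+ (a ℚ.* e ℚ.- b ℚ.* f)
  re-distribˡ = solve 6 (λ a b c d e f →
    a :* (c :+ e) :- b :* (d :+ f) := (a :* c :- b :* d) :+ (a :* e :- b :* f)) refl

  im-distribˡ : ∀ a b c d e f → a ℚ.* (d ℚ.+ f) ℚ.+ b ℚ.* (c ℚ.+ e)
    ≡ (a ℚ.* d ℚ.+ b ℚ.* c) ℚ.+ (a ℚ.* f ℚ.+ b ℚ.* e)
  im-distribˡ = solve 6 (λ a b c d e f →
    a :* (d :+ f) :+ b :* (c :+ e) := (a :* d :+ b :* c) :+ (a :* f :+ b :* e)) refl

  re-distribʳ : ∀ a b c d e f → (c ℚ.+ e) ℚ.* a ℚ.- (d ℚ.+ f) ℚ.* b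
    ≡ (c ℚ.* a ℚ.- d ℚ.* b) ℚ.+ (e ℚ.* a ℚ.- f ℚ.* b)
  re-distribʳ = solve 6 (λ a b c d e f →
    (c :+ e) :* a :- (d :+ f) :* b := (c :* a :- d :* b) :+ (e :* a :- f :* b)) refl

  im-distribʳ : ∀ a b c d e f → (c ℚ.+ e) ℚ.* b ℚ.+ (d ℚ.+ f) ℚ.* a
    ≡ (c ℚ.* b ℚ.+ d ℚ.* a) ℚ.+ (e ℚ.* b ℚ.+ f ℚ.* a)
  im-distribʳ = solve 6 (λ a b c d e f →
    (c :+ e) :* b :+ (d :+ f) :* a := (c :* b :+ d :* a) :+ (e :* b :+ f :* a)) refl

open ℚ-identities

∣+∣< : ∀ {ε} a b → ∣ a ∣ ℚ.< ε ℚ.* ½ → ∣ b ∣ ℚ.< ε ℚ.* ½ → ∣ a ℚ.+ b ∣ ℚ.< ε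
∣+∣< {ε} a b a< b< = begin-strict
  ∣ a ℚ.+ b ∣          ≤⟨ ℚ.∣p+q∣≤∣p∣+∣q∣ a b ⟩
  ∣ a ∣ ℚ.+ ∣ b ∣      <⟨ ℚ.+-mono-< a< b< ⟩
  ε ℚ.* ½ ℚ.+ ε ℚ.* ½  ≡⟨ half+half ε ⟩
  ε                    ∎
  where open ℚ.≤-Reasoning

p≤∣p∣ : ∀ p → p ℚ.≤ ∣ p ∣
p≤∣p∣ p with ℚ.≤-total 0ℚ p
... | inj₁ 0≤p = ℚ.≤-reflexive (≡.sym (ℚ.0≤p⇒∣p∣≡p 0≤p))
... | inj₂ p≤0 = ℚ.≤-trans p≤0 (ℚ.0≤∣p∣ p)

≈ˢ-sym : f ≈ˢ g → g ≈ˢ f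
≈ˢ-sym {f} {g} f≈g ε 0<ε =
  let N , close = f≈g ε 0<ε
  in N , λ n n≥ → begin-strict
    ∣ g n ℚ.- f n ∣         ≡⟨ cong ∣_∣ (swap-sub (f n) (g n)) ⟨
    ∣ ℚ.- (f n ℚ.- g n) ∣   ≡⟨ ℚ.∣-p∣≡∣p∣ (f n ℚ.- g n) ⟩
    ∣ f n ℚ.- g n ∣         <⟨ close n n≥ ⟩
    ε                       ∎
  where open ℚ.≤-Reasoning

≈ˢ-trans : f ≈ˢ g → g ≈ˢ h → f ≈ˢ h
≈ˢ-trans {f} {g} {h} f≈g g≈h ε 0<ε =
  let N , close = eventually-× (f≈g (ε ℚ.* ½) (halve 0<ε)) (g≈h (ε ℚ.* ½) (halve 0<ε))
  in N , λ n n≥ → begin-strict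
    ∣ f n ℚ.- h n ∣                       ≡⟨ cong ∣_∣ (sub-trans (f n) (g n) (h n)) ⟩
    ∣ (f n ℚ.- g n) ℚ.+ (g n ℚ.- h n) ∣
      <⟨ ∣+∣< (f n ℚ.- g n) (g n ℚ.- h n) (proj₁ (close n n≥)) (proj₂ (close n n≥)) ⟩
    ε                                     ∎
  where open ℚ.≤-Reasoning

≈ˢ-+ : f ≈ˢ g → h ≈ˢ k → (λ n → f n ℚ.+ h n) ≈ˢ (λ n → g n ℚ.+ k n)
≈ˢ-+ {f} {g} {h} {k} f≈g h≈k ε 0<ε =
  let N , close = eventually-× (f≈g (ε ℚ.* ½) (halve 0<ε)) (h≈k (ε ℚ.* ½) (halve 0<ε))
  in N , λ n n≥ → begin-strict
    ∣ (f n ℚ.+ h n) ℚ.- (g n ℚ.+ k n) ∣   ≡⟨ cong ∣_∣ (add-sub-add (f n) (g n) (h n) (k n)) ⟩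
    ∣ (f n ℚ.- g n) ℚ.+ (h n ℚ.- k n) ∣
      <⟨ ∣+∣< (f n ℚ.- g n) (h n ℚ.- k n) (proj₁ (close n n≥)) (proj₂ (close n n≥)) ⟩
    ε                                     ∎
  where open ℚ.≤-Reasoning

∣-∣-neg : ∀ p q → ∣ q ℚ.- p ∣ ≡ ∣ ℚ.- p ℚ.- ℚ.- q ∣
∣-∣-neg p q = ≡.sym (cong ∣_∣ (neg-sub-neg p q))

≈ˢ-neg : f ≈ˢ g → (λ n → ℚ.- f n) ≈ˢ (λ n → ℚ.- g n)
≈ˢ-neg {f} {g} f≈g ε 0<ε =
  let N , close = ≈ˢ-sym {f} {g} f≈g ε 0<ε
  in N , λ n n≥ → subst (ℚ._< ε) (∣-∣-neg (f n) (g n)) (close n n≥)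

cauchy⇒bounded : IsCauchy f → ∃[ B ] (0ℚ ℚ.< B × Eventually (λ n → ∣ f n ∣ ℚ.≤ B))
cauchy⇒bounded {f} f-cauchy =
  let N , close = f-cauchy 1ℚ (ℚ.positive⁻¹ 1ℚ)
  in
  ∣ f N ∣ ℚ.+ 1ℚ , ℚ.+-mono-≤-< (ℚ.0≤∣p∣ (f N)) (ℚ.positive⁻¹ 1ℚ) , N , λ n n≥ → begin
    ∣ f n ∣                          ≡⟨ cong ∣_∣ (add-sub (f n) (f N)) ⟨
    ∣ f N ℚ.+ (f n ℚ.- f N) ∣        ≤⟨ ℚ.∣p+q∣≤∣p∣+∣q∣ (f N) (f n ℚ.- f N) ⟩
    ∣ f N ∣ ℚ.+ ∣ f n ℚ.- f N ∣      <⟨ ℚ.+-monoʳ-< ∣ f N ∣ (close n N n≥ ℕ.≤-refl) ⟩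
    ∣ f N ∣ ℚ.+ 1ℚ                   ∎
  where open ℚ.≤-Reasoning

-- Multiplication respects limits only if the fixed factor stays bounded, which is what the Cauchy
-- property supplies: with ∣h∣ eventually at most B, a tolerance of ε/B for `f` and `g` suffices.
≈ˢ-*ˡ : IsCauchy h → f ≈ˢ g → (λ n → h n ℚ.* f n) ≈ˢ (λ n → h n ℚ.* g n)
≈ˢ-*ˡ {h} {f} {g} h-cauchy f≈g ε 0<ε =
  let B , 0<B , bound = cauchy⇒bounded {h} h-cauchy
      δ , 0<δ , Bδ≡ε = scale B 0<B ε 0<ε
      N , close = eventually-× bound (f≈g δ 0<δ)
  in N , λ n n≥ → begin-strict
    ∣ h n ℚ.* f n ℚ.- h n ℚ.* g n ∣  ≡⟨ cong ∣_∣ (mul-sub (h n) (f n) (g n)) ⟩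
    ∣ h n ℚ.* (f n ℚ.- g n) ∣        ≡⟨ ℚ.∣p*q∣≡∣p∣*∣q∣ (h n) (f n ℚ.- g n) ⟩
    ∣ h n ∣ ℚ.* ∣ f n ℚ.- g n ∣
      ≤⟨ ℚ.*-monoʳ-≤-nonNeg ∣ f n ℚ.- g n ∣ {{ℚ.nonNegative (ℚ.0≤∣p∣ (f n ℚ.- g n))}}
           (proj₁ (close n n≥)) ⟩
    B ℚ.* ∣ f n ℚ.- g n ∣            <⟨ ℚ.*-monoʳ-<-pos B {{ℚ.positive 0<B}} (proj₂ (close n n≥)) ⟩
    B ℚ.* δ                          ≡⟨ Bδ≡ε ⟩
    ε                                ∎
  where open ℚ.≤-Reasoning

≈ˢ⇒≤ˢ : f ≈ˢ g → f ≤ˢ g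
≈ˢ⇒≤ˢ {f} {g} f≈g ε 0<ε =
  let N , close = f≈g ε 0<ε
  in N , λ n n≥ → begin-strict
    f n                          ≡⟨ add-sub (f n) (g n) ⟨
    g n ℚ.+ (f n ℚ.- g n)        ≤⟨ ℚ.+-monoʳ-≤ (g n) (p≤∣p∣ (f n ℚ.- g n)) ⟩
    g n ℚ.+ ∣ f n ℚ.- g n ∣      <⟨ ℚ.+-monoʳ-< (g n) (close n n≥) ⟩
    g n ℚ.+ ε                    ∎
  where open ℚ.≤-Reasoning

≤ˢ-trans : f ≤ˢ g → g ≤ˢ h → f ≤ˢ h
≤ˢ-trans {f} {g} {h} f≤g g≤h ε 0<ε =
  let N , close = eventually-× (f≤g (ε ℚ.* ½) (halve 0<ε)) (g≤h (ε ℚ.* ½) (halve 0<ε))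
  in N , λ n n≥ → begin-strict
    f n                              <⟨ proj₁ (close n n≥) ⟩
    g n ℚ.+ ε ℚ.* ½                  <⟨ ℚ.+-monoˡ-< (ε ℚ.* ½) (proj₂ (close n n≥)) ⟩
    (h n ℚ.+ ε ℚ.* ½) ℚ.+ ε ℚ.* ½    ≡⟨ ℚ.+-assoc (h n) (ε ℚ.* ½) (ε ℚ.* ½) ⟩
    h n ℚ.+ (ε ℚ.* ½ ℚ.+ ε ℚ.* ½)    ≡⟨ cong (h n ℚ.+_) (half+half ε) ⟩
    h n ℚ.+ ε                        ∎
  where open ℚ.≤-Reasoning

≤ˢ-+ : f ≤ˢ g → h ≤ˢ k → (λ n → f n ℚ.+ h n) ≤ˢ (λ n → g n ℚ.+ k n)
≤ˢ-+ {f} {g} {h} {k} f≤g h≤k ε 0<ε =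
  let N , close = eventually-× (f≤g (ε ℚ.* ½) (halve 0<ε)) (h≤k (ε ℚ.* ½) (halve 0<ε))
  in N , λ n n≥ → begin-strict
    f n ℚ.+ h n
      <⟨ ℚ.+-mono-< (proj₁ (close n n≥)) (proj₂ (close n n≥)) ⟩
    (g n ℚ.+ ε ℚ.* ½) ℚ.+ (k n ℚ.+ ε ℚ.* ½)
      ≡⟨ add-interchange (g n) (ε ℚ.* ½) (k n) (ε ℚ.* ½) ⟩
    (g n ℚ.+ k n) ℚ.+ (ε ℚ.* ½ ℚ.+ ε ℚ.* ½)
      ≡⟨ cong ((g n ℚ.+ k n) ℚ.+_) (half+half ε) ⟩
    (g n ℚ.+ k n) ℚ.+ ε ∎
  where open ℚ.≤-Reasoning

≤ˢ-* : ∀ q → 0ℚ ℚ.< q → f ≤ˢ g → (λ n → q ℚ.* f n) ≤ˢ (λ n → q ℚ.* g n)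
≤ˢ-* {f} {g} q 0<q f≤g ε 0<ε =
  let δ , 0<δ , qδ≡ε = scale q 0<q ε 0<ε
      N , close = f≤g δ 0<δ
  in N , λ n n≥ → begin-strict
    q ℚ.* f n              <⟨ ℚ.*-monoʳ-<-pos q {{ℚ.positive 0<q}} (close n n≥) ⟩
    q ℚ.* (g n ℚ.+ δ)      ≡⟨ ℚ.*-distribˡ-+ q (g n) δ ⟩
    q ℚ.* g n ℚ.+ q ℚ.* δ  ≡⟨ cong (q ℚ.* g n ℚ.+_) qδ≡ε ⟩
    q ℚ.* g n ℚ.+ ε        ∎
  where open ℚ.≤-Reasoning

pointwise-≈ˢ : (∀ n → f n ≡ g n) → f ≈ˢ g
pointwise-≈ˢ {f} {g} f≗g ε 0<ε = 0 , λ n _ → begin-strict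
    ∣ f n ℚ.- g n ∣   ≡⟨ cong (λ p → ∣ p ℚ.- g n ∣) (f≗g n) ⟩
    ∣ g n ℚ.- g n ∣   ≡⟨ cong ∣_∣ (ℚ.+-inverseʳ (g n)) ⟩
    0ℚ                <⟨ 0<ε ⟩
    ε                 ∎
  where open ℚ.≤-Reasoning

pointwise-≤ˢ : (∀ n → f n ℚ.≤ g n) → f ≤ˢ g
pointwise-≤ˢ {f} {g} f≤g ε 0<ε = 0 , λ n _ → begin-strict
    f n          ≤⟨ f≤g n ⟩
    g n          ≡⟨ ℚ.+-identityʳ (g n) ⟨
    g n ℚ.+ 0ℚ   <⟨ ℚ.+-monoʳ-< (g n) 0<ε ⟩
    g n ℚ.+ ε    ∎
  where open ℚ.≤-Reasoning

-- The real numbers as an ordered ring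

pointwise-≈ : ∀ x y → (∀ n → seq x n ≡ seq y n) → x ≈ᴿ y
pointwise-≈ x y = pointwise-≈ˢ {seq x} {seq y}

≈ᴿ-isEquivalence : IsEquivalence _≈ᴿ_
≈ᴿ-isEquivalence = record
  { refl  = λ {x} → pointwise-≈ x x (λ _ → refl)
  ; sym   = λ {x} {y} → ≈ˢ-sym {seq x} {seq y}
  ; trans = λ {x} {y} {z} → ≈ˢ-trans {seq x} {seq y} {seq z}
  }

*ᴿ-comm : ∀ x y → x *ᴿ y ≈ᴿ y *ᴿ x
*ᴿ-comm x y = pointwise-≈ (x *ᴿ y) (y *ᴿ x) (λ n → ℚ.*-comm (seq x n) (seq y n))

*ᴿ-cong : ∀ x y u v → x ≈ᴿ y → u ≈ᴿ v → x *ᴿ u ≈ᴿ y *ᴿ v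
*ᴿ-cong x y u v x≈y u≈v =
  trans {x *ᴿ u} {x *ᴿ v} {y *ᴿ v} (*ᴿ-congˡ x u v u≈v)
    (trans {x *ᴿ v} {v *ᴿ x} {y *ᴿ v} (*ᴿ-comm x v)
      (trans {v *ᴿ x} {v *ᴿ y} {y *ᴿ v} (*ᴿ-congˡ v x y x≈y) (*ᴿ-comm v y)))
  where
  open IsEquivalence ≈ᴿ-isEquivalence using (trans)
  *ᴿ-congˡ : ∀ z x y → x ≈ᴿ y → z *ᴿ x ≈ᴿ z *ᴿ y
  *ᴿ-congˡ z x y = ≈ˢ-*ˡ {seq z} {seq x} {seq y} (cauchy z)

ℝ-commutativeRing : CommutativeRing 0ℓ 0ℓ
ℝ-commutativeRing = record
  { Carrier = ℝ ; _≈_ = _≈ᴿ_ ; _+_ = _+ᴿ_ ; _*_ = _*ᴿ_ ; -_ = -ᴿ_ ; 0# = 0ᴿ ; 1# = 1ᴿ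
  ; isCommutativeRing = record
    { isRing = record
      { +-isAbelianGroup = record
        { isGroup = record
          { isMonoid = record
            { isSemigroup = record
              { isMagma = record
                { isEquivalence = ≈ᴿ-isEquivalence
                ; ∙-cong = λ {x} {y} {u} {v} → ≈ˢ-+ {seq x} {seq y} {seq u} {seq v}
                }
              ; assoc = λ x y z → pointwise-≈ ((x +ᴿ y) +ᴿ z) (x +ᴿ (y +ᴿ z))
                                    (λ n → ℚ.+-assoc (seq x n) (seq y n) (seq z n))
              }
            ; identity = (λ x → pointwise-≈ (0ᴿ +ᴿ x) x (λ n → ℚ.+-identityˡ (seq x n)))
                       , (λ x → pointwise-≈ (x +ᴿ 0ᴿ) x (λ n → ℚ.+-identityʳ (seq x n)))
            }
          ; inverse = (λ x → pointwise-≈ ((-ᴿ x) +ᴿ x) 0ᴿ (λ n → ℚ.+-inverseˡ (seq x n)))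
                    , (λ x → pointwise-≈ (x -ᴿ x) 0ᴿ (λ n → ℚ.+-inverseʳ (seq x n)))
          ; ⁻¹-cong = λ {x} {y} → ≈ˢ-neg {seq x} {seq y}
          }
        ; comm = λ x y → pointwise-≈ (x +ᴿ y) (y +ᴿ x) (λ n → ℚ.+-comm (seq x n) (seq y n))
        }
      ; *-cong = λ {x} {y} {u} {v} → *ᴿ-cong x y u v
      ; *-assoc = λ x y z → pointwise-≈ ((x *ᴿ y) *ᴿ z) (x *ᴿ (y *ᴿ z))
                              (λ n → ℚ.*-assoc (seq x n) (seq y n) (seq z n))
      ; *-identity = (λ x → pointwise-≈ (1ᴿ *ᴿ x) x (λ n → ℚ.*-identityˡ (seq x n)))
                   , (λ x → pointwise-≈ (x *ᴿ 1ᴿ) x (λ n → ℚ.*-identityʳ (seq x n)))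
      ; distrib = (λ x y z → pointwise-≈ (x *ᴿ (y +ᴿ z)) (x *ᴿ y +ᴿ x *ᴿ z)
                               (λ n → ℚ.*-distribˡ-+ (seq x n) (seq y n) (seq z n)))
                , (λ x y z → pointwise-≈ ((y +ᴿ z) *ᴿ x) (y *ᴿ x +ᴿ z *ᴿ x)
                               (λ n → ℚ.*-distribʳ-+ (seq x n) (seq y n) (seq z n)))
      }
    ; *-comm = *ᴿ-comm
    }
  }

-- x ≈ᴿ y and x ≤ᴿ y unfold to statements about sequences from which x and y cannot be
-- inferred; in the form of record types they can.
module Boxed (R : CommutativeRing 0ℓ 0ℓ) where
  private module R = CommutativeRing R

  infix 4 _≋_

  record _≋_ (x y : R.Carrier) : Set where
    constructor box
    field unbox : x R.≈ y

  open _≋_ public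

  commutativeRing : CommutativeRing 0ℓ 0ℓ
  commutativeRing = record
    { Carrier = R.Carrier ; _≈_ = _≋_ ; _+_ = R._+_ ; _*_ = R._*_ ; -_ = R.-_
    ; 0# = R.0# ; 1# = R.1#
    ; isCommutativeRing = record
      { isRing = record
        { +-isAbelianGroup = record
          { isGroup = record
            { isMonoid = record
              { isSemigroup = record
                { isMagma = record
                  { isEquivalence = record
                    { refl  = box R.refl
                    ; sym   = λ p → box (R.sym (unbox p))
                    ; trans = λ p q → box (R.trans (unbox p) (unbox q))
                    }
                  ; ∙-cong = λ p q → box (R.+-cong (unbox p) (unbox q))
                  }
                ; assoc = λ x y z → box (R.+-assoc x y z)
                }
              ; identity = (λ x → box (R.+-identityˡ x)) , (λ x → box (R.+-identityʳ x))
              }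
            ; inverse = (λ x → box (R.-‿inverseˡ x)) , (λ x → box (R.-‿inverseʳ x))
            ; ⁻¹-cong = λ p → box (R.-‿cong (unbox p))
            }
          ; comm = λ x y → box (R.+-comm x y)
          }
        ; *-cong = λ p q → box (R.*-cong (unbox p) (unbox q))
        ; *-assoc = λ x y z → box (R.*-assoc x y z)
        ; *-identity = (λ x → box (R.*-identityˡ x)) , (λ x → box (R.*-identityʳ x))
        ; distrib = (λ x y z → box (R.distribˡ x y z)) , (λ x y z → box (R.distribʳ x y z))
        }
      ; *-comm = λ x y → box (R.*-comm x y)
      }
    }

open Boxed ℝ-commutativeRing public
  renaming (_≋_ to _≈ℝ_; box to boxℝ; unbox to unboxℝ; commutativeRing to ℝ-ring)

infix 4 _≤ℝ_

record _≤ℝ_ (x y : ℝ) : Set where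
  constructor box≤
  field unbox≤ : x ≤ᴿ y

open _≤ℝ_ public

≤ℝ-preorder : Preorder 0ℓ 0ℓ 0ℓ
≤ℝ-preorder = record
  { Carrier = ℝ ; _≈_ = _≈ℝ_ ; _≲_ = _≤ℝ_
  ; isPreorder = record
    { isEquivalence = CommutativeRing.isEquivalence ℝ-ring
    ; reflexive     = λ {x} {y} x≈y → box≤ (≈ˢ⇒≤ˢ {seq x} {seq y} (unboxℝ x≈y))
    ; trans         = λ {x} {y} {z} x≤y y≤z →
        box≤ (≤ˢ-trans {seq x} {seq y} {seq z} (unbox≤ x≤y) (unbox≤ y≤z))
    }
  }

pointwise : ∀ {x y} → (∀ n → seq x n ≡ seq y n) → x ≈ℝ y
pointwise {x} {y} x≗y = boxℝ (pointwise-≈ x y x≗y)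

pointwise-≤ : ∀ {x y} → (∀ n → seq x n ℚ.≤ seq y n) → x ≤ℝ y
pointwise-≤ {x} {y} x≤y = box≤ (pointwise-≤ˢ {seq x} {seq y} x≤y)

+ᴿ-mono-≤ : ∀ {x y u v} → x ≤ℝ y → u ≤ℝ v → x +ᴿ u ≤ℝ y +ᴿ v
+ᴿ-mono-≤ {x} {y} {u} {v} x≤y u≤v =
  box≤ (≤ˢ-+ {seq x} {seq y} {seq u} {seq v} (unbox≤ x≤y) (unbox≤ u≤v))

*ᴿ-monoʳ-≤ : ∀ q {x y} → 0ℚ ℚ.< q → x ≤ℝ y → fromℚ q *ᴿ x ≤ℝ fromℚ q *ᴿ y
*ᴿ-monoʳ-≤ q {x} {y} 0<q x≤y = box≤ (≤ˢ-* {seq x} {seq y} q 0<q (unbox≤ x≤y))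

-- Takes the place of division by a weight: the conclusion with tolerance ε follows from the
-- hypothesis with tolerance qε.
*ᴿ-cancelˡ-≤ : ∀ q {x y} → 0ℚ ℚ.< q → fromℚ q *ᴿ x ≤ℝ fromℚ q *ᴿ y → x ≤ℝ y
*ᴿ-cancelˡ-≤ q {x} {y} 0<q qx≤qy = box≤ λ ε 0<ε →
  let N , close = unbox≤ qx≤qy (q ℚ.* ε) (0<q*ε 0<ε)
  in N , λ n n≥ →
    ℚ.*-cancelˡ-<-nonNeg q {{ℚ.pos⇒nonNeg q {{ℚ.positive 0<q}}}}
      (subst (q ℚ.* seq x n ℚ.<_) (≡.sym (ℚ.*-distribˡ-+ q (seq y n) ε)) (close n n≥))
  where
  0<q*ε : ∀ {ε} → 0ℚ ℚ.< ε → 0ℚ ℚ.< q ℚ.* ε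
  0<q*ε {ε} 0<ε = ℚ.positive⁻¹ (q ℚ.* ε) {{ℚ.pos*pos⇒pos q {{ℚ.positive 0<q}} ε {{ℚ.positive 0<ε}}}}

-- Brings the final estimate back from limits to numbers. If q were below p, the tolerance p - q
-- would yield p < p.
fromℚ-cancel-≤ : ∀ {p q} → fromℚ p ≤ℝ fromℚ q → p ℚ.≤ q
fromℚ-cancel-≤ {p} {q} (box≤ p≤q) = ℚ.≮⇒≥ λ q<p →
  let N , close = p≤q (p ℚ.- q) (subst (ℚ._< p ℚ.- q) (ℚ.+-inverseʳ q) (ℚ.+-monoˡ-< (ℚ.- q) q<p))
  in ℚ.<-irrefl refl (subst (p ℚ.<_) (add-sub p q) (close N ℕ.≤-refl))

-- The ring of complex numbers

infix 8 -ᶜ_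

-ᶜ_ : ℂ → ℂ
-ᶜ z = (-ᴿ re z) +i (-ᴿ im z)

≈ᶜ-isEquivalence : IsEquivalence _≈ᶜ_
≈ᶜ-isEquivalence = record
  { refl  = λ {z} → R.refl {re z} , R.refl {im z}
  ; sym   = λ {w} {z} (p , q) → R.sym {re w} {re z} p , R.sym {im w} {im z} q
  ; trans = λ {v} {w} {z} (p , q) (p′ , q′) →
      R.trans {re v} {re w} {re z} p p′ , R.trans {im v} {im w} {im z} q q′
  }
  where module R = IsEquivalence ≈ᴿ-isEquivalence

pointwise-≈ᶜ : ∀ w z → (∀ n → seq (re w) n ≡ seq (re z) n) → (∀ n → seq (im w) n ≡ seq (im z) n) →
               w ≈ᶜ z
pointwise-≈ᶜ w z re≡ im≡ = pointwise-≈ (re w) (re z) re≡ , pointwise-≈ (im w) (im z) im≡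

*ᶜ-cong : ∀ w w′ z z′ → w ≈ᶜ w′ → z ≈ᶜ z′ → w *ᶜ z ≈ᶜ w′ *ᶜ z′
*ᶜ-cong w w′ z z′ (a≈ , b≈) (c≈ , d≈) =
  R.+-cong {a *ᴿ c} {a′ *ᴿ c′} { -ᴿ (b *ᴿ d)} { -ᴿ (b′ *ᴿ d′)} (*ᴿ-cong a a′ c c′ a≈ c≈)
    (R.-‿cong {b *ᴿ d} {b′ *ᴿ d′} (*ᴿ-cong b b′ d d′ b≈ d≈)) ,
  R.+-cong {a *ᴿ d} {a′ *ᴿ d′} {b *ᴿ c} {b′ *ᴿ c′} (*ᴿ-cong a a′ d d′ a≈ d≈)
    (*ᴿ-cong b b′ c c′ b≈ c≈)
  where
  module R = CommutativeRing ℝ-commutativeRing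
  a  = re w
  b  = im w
  c  = re z
  d  = im z
  a′ = re w′
  b′ = im w′
  c′ = re z′
  d′ = im z′

ℂ-commutativeRing : CommutativeRing 0ℓ 0ℓ
ℂ-commutativeRing = record
  { Carrier = ℂ ; _≈_ = _≈ᶜ_ ; _+_ = _+ᶜ_ ; _*_ = _*ᶜ_ ; -_ = -ᶜ_ ; 0# = 0ᶜ ; 1# = 1ᶜ
  ; isCommutativeRing = record
    { isRing = record
      { +-isAbelianGroup = record
        { isGroup = record
          { isMonoid = record
            { isSemigroup = record
              { isMagma = record
                { isEquivalence = ≈ᶜ-isEquivalence
                ; ∙-cong = λ {w} {w′} {z} {z′} (p , q) (p′ , q′) →
                    R.+-cong {re w} {re w′} {re z} {re z′} p p′ ,
                    R.+-cong {im w} {im w′} {im z} {im z′} q q′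
                }
              ; assoc = λ v w z → R.+-assoc (re v) (re w) (re z) , R.+-assoc (im v) (im w) (im z)
              }
            ; identity = (λ z → R.+-identityˡ (re z) , R.+-identityˡ (im z))
                       , (λ z → R.+-identityʳ (re z) , R.+-identityʳ (im z))
            }
          ; inverse = (λ z → R.-‿inverseˡ (re z) , R.-‿inverseˡ (im z))
                    , (λ z → R.-‿inverseʳ (re z) , R.-‿inverseʳ (im z))
          ; ⁻¹-cong = λ {w} {z} (p , q) → R.-‿cong {re w} {re z} p , R.-‿cong {im w} {im z} q
          }
        ; comm = λ w z → R.+-comm (re w) (re z) , R.+-comm (im w) (im z)
        }
      ; *-cong = λ {w} {w′} {z} {z′} → *ᶜ-cong w w′ z z′
      ; *-assoc = *ᶜ-assoc
      ; *-identity = *ᶜ-identityˡ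
                   , (λ z → trans {z *ᶜ 1ᶜ} {1ᶜ *ᶜ z} {z} (*ᶜ-comm z 1ᶜ) (*ᶜ-identityˡ z))
      ; distrib = *ᶜ-distribˡ , *ᶜ-distribʳ
      }
    ; *-comm = *ᶜ-comm
    }
  }
  where
  module R = CommutativeRing ℝ-commutativeRing
  open IsEquivalence ≈ᶜ-isEquivalence using (trans)

  *ᶜ-assoc : ∀ v w z → (v *ᶜ w) *ᶜ z ≈ᶜ v *ᶜ (w *ᶜ z)
  *ᶜ-assoc v w z = pointwise-≈ᶜ ((v *ᶜ w) *ᶜ z) (v *ᶜ (w *ᶜ z))
    (λ n → re-assoc (seq (re v) n) (seq (im v) n) (seq (re w) n) (seq (im w) n)
                     (seq (re z) n) (seq (im z) n))
    (λ n → im-assoc (seq (re v) n) (seq (im v) n) (seq (re w) n) (seq (im w) n)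
                     (seq (re z) n) (seq (im z) n))

  *ᶜ-comm : ∀ w z → w *ᶜ z ≈ᶜ z *ᶜ w
  *ᶜ-comm w z = pointwise-≈ᶜ (w *ᶜ z) (z *ᶜ w)
    (λ n → re-comm (seq (re w) n) (seq (im w) n) (seq (re z) n) (seq (im z) n))
    (λ n → im-comm (seq (re w) n) (seq (im w) n) (seq (re z) n) (seq (im z) n))

  *ᶜ-identityˡ : ∀ z → 1ᶜ *ᶜ z ≈ᶜ z
  *ᶜ-identityˡ z = pointwise-≈ᶜ (1ᶜ *ᶜ z) z
    (λ n → re-identity (seq (re z) n) (seq (im z) n))
    (λ n → im-identity (seq (re z) n) (seq (im z) n))

  *ᶜ-distribˡ : ∀ v w z → v *ᶜ (w +ᶜ z) ≈ᶜ v *ᶜ w +ᶜ v *ᶜ z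
  *ᶜ-distribˡ v w z = pointwise-≈ᶜ (v *ᶜ (w +ᶜ z)) (v *ᶜ w +ᶜ v *ᶜ z)
    (λ n → re-distribˡ (seq (re v) n) (seq (im v) n) (seq (re w) n) (seq (im w) n)
                     (seq (re z) n) (seq (im z) n))
    (λ n → im-distribˡ (seq (re v) n) (seq (im v) n) (seq (re w) n) (seq (im w) n)
                     (seq (re z) n) (seq (im z) n))

  *ᶜ-distribʳ : ∀ v w z → (w +ᶜ z) *ᶜ v ≈ᶜ w *ᶜ v +ᶜ z *ᶜ v
  *ᶜ-distribʳ v w z = pointwise-≈ᶜ ((w +ᶜ z) *ᶜ v) (w *ᶜ v +ᶜ z *ᶜ v)
    (λ n → re-distribʳ (seq (re v) n) (seq (im v) n) (seq (re w) n) (seq (im w) n)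
                     (seq (re z) n) (seq (im z) n))
    (λ n → im-distribʳ (seq (re v) n) (seq (im v) n) (seq (re w) n) (seq (im w) n)
                     (seq (re z) n) (seq (im z) n))

open Boxed ℂ-commutativeRing public
  renaming (_≋_ to _≈ℂ_; box to boxℂ; unbox to unboxℂ; commutativeRing to ℂ-ring)

module R  = CommutativeRing ℝ-ring
module C  = CommutativeRing ℂ-ring
module ∑R = ListSum ℝ-ring
module ∑C = ListSum ℂ-ring

-- Basis labels

bitStrings-unique : ∀ b → Unique (bitStrings b)
bitStrings-unique zero    = [] ∷ []
bitStrings-unique (suc b) =
  Unique.++⁺ (Unique.map⁺ Vec.∷-injectiveʳ (bitStrings-unique b))
             (Unique.map⁺ Vec.∷-injectiveʳ (bitStrings-unique b)) disjoint
  where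
  disjoint : ∀ {v} → v ∈ List.map (false ∷_) (bitStrings b) × v ∈ List.map (true ∷_) (bitStrings b) →
             _
  disjoint (v∈₀ , v∈₁) with ∈-map⁻ (false ∷_) v∈₀ | ∈-map⁻ (true ∷_) v∈₁
  ... | _ , _ , refl | _ , _ , ()

∈-bitStrings : ∀ {b} (v : Vec Bool b) → v ∈ bitStrings b
∈-bitStrings []                    = here refl
∈-bitStrings (false ∷ v)           = ∈-++⁺ˡ (∈-map⁺ (false ∷_) (∈-bitStrings v))
∈-bitStrings {suc b} (true ∷ v)    =
  ∈-++⁺ʳ (List.map (false ∷_) (bitStrings b)) (∈-map⁺ (true ∷_) (∈-bitStrings v))

⊕-involutive : ∀ {b} (c d : Vec Bool b) → (c ⊕ d) ⊕ d ≡ c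
⊕-involutive []          []          = refl
⊕-involutive (x ∷ c)     (y ∷ d)     = cong₂ _∷_ (xor-involutive x y) (⊕-involutive c d)
  where
  xor-involutive : ∀ x y → (x xor y) xor y ≡ x
  xor-involutive x y = ≡.trans (Bool.xor-assoc x y y)
    (≡.trans (cong (x xor_) (Bool.xor-same y)) (Bool.xor-identityʳ x))

-- Squared norms and distances

private module ℚ-norms where
  open +-*-Solver

  re-conj-* : ∀ a b → a ℚ.* a ℚ.- (ℚ.- b) ℚ.* b ≡ a ℚ.* a ℚ.+ b ℚ.* b
  re-conj-* = solve 2 (λ a b → a :* a :- (:- b) :* b := a :* a :+ b :* b) refl

  im-conj-* : ∀ a b c d → ℚ.- (a ℚ.* d ℚ.+ b ℚ.* c) ≡ a ℚ.* (ℚ.- d) ℚ.+ (ℚ.- b) ℚ.* c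
  im-conj-* = solve 4 (λ a b c d → :- (a :* d :+ b :* c) := a :* (:- d) :+ (:- b) :* c) refl

  re-conj-*′ : ∀ a b c d → a ℚ.* c ℚ.- b ℚ.* d ≡ a ℚ.* c ℚ.- (ℚ.- b) ℚ.* (ℚ.- d)
  re-conj-*′ = solve 4 (λ a b c d → a :* c :- b :* d := a :* c :- (:- b) :* (:- d)) refl

  -- With u = a + bi and v = c + di this reads (1 + q)∣u∣² + q(1 + q)∣v∣² = q∣u + v∣² + ∣u - qv∣².
  -- The right side is bracketed as two successive additions of a rational square, ready for two
  -- uses of `p≤p+r*r`.
  peter-paul-gap : ∀ q a b c d →
    (1ℚ ℚ.+ q) ℚ.* (a ℚ.* a ℚ.+ b ℚ.* b) ℚ.+ q ℚ.* (1ℚ ℚ.+ q) ℚ.* (c ℚ.* c ℚ.+ d ℚ.* d)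
    ≡ (q ℚ.* ((a ℚ.+ c) ℚ.* (a ℚ.+ c) ℚ.+ (b ℚ.+ d) ℚ.* (b ℚ.+ d))
        ℚ.+ (a ℚ.- q ℚ.* c) ℚ.* (a ℚ.- q ℚ.* c)) ℚ.+ (b ℚ.- q ℚ.* d) ℚ.* (b ℚ.- q ℚ.* d)
  peter-paul-gap = solve 5 (λ q a b c d →
    (con 1ℚ :+ q) :* (a :* a :+ b :* b) :+ q :* (con 1ℚ :+ q) :* (c :* c :+ d :* d)
    := (q :* ((a :+ c) :* (a :+ c) :+ (b :+ d) :* (b :+ d))
        :+ (a :- q :* c) :* (a :- q :* c)) :+ (b :- q :* d) :* (b :- q :* d)) refl

open ℚ-norms

module _ {A : Set} where

  norm² : List A → (A → ℂ) → ℝ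
  norm² xs ψ = ∑ᴿ xs (λ x → ∣ ψ x ∣²)

  dist² : List A → (A → ℂ) → (A → ℂ) → ℝ
  dist² xs φ ψ = norm² xs (λ x → φ x +ᶜ -ᶜ ψ x)

  ∑-mono : ∀ xs {f g : A → ℝ} → (∀ x → f x ≤ℝ g x) → ∑ᴿ xs f ≤ℝ ∑ᴿ xs g
  ∑-mono []       f≤g = pointwise-≤ (λ _ → ℚ.≤-refl)
  ∑-mono (x ∷ xs) f≤g = +ᴿ-mono-≤ (f≤g x) (∑-mono xs f≤g)

  -- The common shape of the weighted bounds below: each is proved for one basis label and summed
  -- here.
  ∑-mono-combination : ∀ p q r xs {f g h : A → ℝ} →
    (∀ x → (p *ᴿ f x) ≤ℝ (q *ᴿ g x +ᴿ r *ᴿ h x)) →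
    (p *ᴿ ∑ᴿ xs f) ≤ℝ (q *ᴿ ∑ᴿ xs g +ᴿ r *ᴿ ∑ᴿ xs h)
  ∑-mono-combination p q r xs {f} {g} {h} f≤ = begin
    p *ᴿ ∑ᴿ xs f                                          ≈⟨ ∑R.*-distribˡ-∑ p xs f ⟩
    ∑ᴿ xs (λ x → p *ᴿ f x)                                ≲⟨ ∑-mono xs f≤ ⟩
    ∑ᴿ xs (λ x → q *ᴿ g x +ᴿ r *ᴿ h x)                    ≈⟨ ∑R.∑-+ xs _ _ ⟩
    ∑ᴿ xs (λ x → q *ᴿ g x) +ᴿ ∑ᴿ xs (λ x → r *ᴿ h x)      ≈⟨ R.+-cong (∑R.*-distribˡ-∑ q xs g)
                                                                      (∑R.*-distribˡ-∑ r xs h) ⟨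
    q *ᴿ ∑ᴿ xs g +ᴿ r *ᴿ ∑ᴿ xs h                          ∎
    where open import Relation.Binary.Reasoning.Preorder ≤ℝ-preorder

∣∣²-cong : ∀ {w z} → w ≈ℂ z → ∣ w ∣² ≈ℝ ∣ z ∣²
∣∣²-cong {w} {z} (boxℂ (re≈ , im≈)) =
  R.+-cong (R.*-cong (boxℝ {re w} {re z} re≈) (boxℝ {re w} {re z} re≈))
           (R.*-cong (boxℝ {im w} {im z} im≈) (boxℝ {im w} {im z} im≈))

norm²-cong : ∀ {A : Set} xs {φ ψ : A → ℂ} → (∀ x → φ x ≈ℂ ψ x) → norm² xs φ ≈ℝ norm² xs ψ
norm²-cong xs φ≈ψ = ∑R.∑-cong xs (λ x → ∣∣²-cong (φ≈ψ x))

re-∑-conj-* : ∀ {A : Set} xs (ψ : A → ℂ) → re (∑ᶜ xs (λ x → conj (ψ x) *ᶜ ψ x)) ≈ℝ norm² xs ψ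
re-∑-conj-* []       ψ = R.refl
re-∑-conj-* (x ∷ xs) ψ =
  R.+-cong (pointwise (λ n → re-conj-* (seq (re (ψ x)) n) (seq (im (ψ x)) n))) (re-∑-conj-* xs ψ)

0≤p*p : ∀ p → 0ℚ ℚ.≤ p ℚ.* p
0≤p*p p with ℚ.≤-total 0ℚ p
... | inj₁ 0≤p = subst (ℚ._≤ p ℚ.* p) (ℚ.*-zeroʳ p) (ℚ.*-monoˡ-≤-nonNeg p {{ℚ.nonNegative 0≤p}} 0≤p)
... | inj₂ p≤0 = subst (ℚ._≤ p ℚ.* p) (ℚ.*-zeroʳ p) (ℚ.*-monoˡ-≤-nonPos p {{ℚ.nonPositive p≤0}} p≤0)

p≤p+r*r : ∀ p r → p ℚ.≤ p ℚ.+ r ℚ.* r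
p≤p+r*r p r = subst (ℚ._≤ p ℚ.+ r ℚ.* r) (ℚ.+-identityʳ p) (ℚ.+-monoʳ-≤ p (0≤p*p r))

0≤∣∣² : ∀ z n → 0ℚ ℚ.≤ seq ∣ z ∣² n
0≤∣∣² z n = ℚ.≤-trans (0≤p*p (seq (re z) n)) (p≤p+r*r _ (seq (im z) n))

-- The weighted form of ∣u + v∣² ≤ 2∣u∣² + 2∣v∣², the difference of both sides being ∣u - qv∣².
peter-paul : ∀ q u v →
  (fromℚ q *ᴿ ∣ u +ᶜ v ∣²) ≤ℝ
  (fromℚ (1ℚ ℚ.+ q) *ᴿ ∣ u ∣² +ᴿ fromℚ (q ℚ.* (1ℚ ℚ.+ q)) *ᴿ ∣ v ∣²)
peter-paul q u v = pointwise-≤ λ n →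
  ℚ.≤-trans (ℚ.≤-trans (p≤p+r*r _ (seq (re u) n ℚ.- q ℚ.* seq (re v) n))
                       (p≤p+r*r _ (seq (im u) n ℚ.- q ℚ.* seq (im v) n)))
    (ℚ.≤-reflexive (≡.sym
      (peter-paul-gap q (seq (re u) n) (seq (im u) n) (seq (re v) n) (seq (im v) n))))

sub-trans-ℂ : ∀ a b c → (a +ᶜ -ᶜ b) +ᶜ (b +ᶜ -ᶜ c) ≈ℂ a +ᶜ -ᶜ c
sub-trans-ℂ a b c = boxℂ (pointwise-≈ᶜ ((a +ᶜ -ᶜ b) +ᶜ (b +ᶜ -ᶜ c)) (a +ᶜ -ᶜ c)
  (λ n → ≡.sym (sub-trans (seq (re a) n) (seq (re b) n) (seq (re c) n)))
  (λ n → ≡.sym (sub-trans (seq (im a) n) (seq (im b) n) (seq (im c) n))))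

add-sub-ℂ : ∀ a b → b +ᶜ (a +ᶜ -ᶜ b) ≈ℂ a
add-sub-ℂ a b = boxℂ (pointwise-≈ᶜ (b +ᶜ (a +ᶜ -ᶜ b)) a
  (λ n → add-sub (seq (re a) n) (seq (re b) n))
  (λ n → add-sub (seq (im a) n) (seq (im b) n)))

∣-z∣² : ∀ z → ∣ -ᶜ z ∣² ≈ℝ ∣ z ∣²
∣-z∣² z = pointwise λ n → cong₂ ℚ._+_ (neg-square (seq (re z) n)) (neg-square (seq (im z) n))
  where
  open +-*-Solver
  neg-square : ∀ p → (ℚ.- p) ℚ.* (ℚ.- p) ≡ p ℚ.* p
  neg-square = solve 1 (λ p → (:- p) :* (:- p) := p :* p) refl

2ℚ 3ℚ 6ℚ : ℚ
2ℚ = 1ℚ ℚ.+ 1ℚ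
3ℚ = 1ℚ ℚ.+ 2ℚ
6ℚ = 2ℚ ℚ.* 3ℚ

module _ {A : Set} (xs : List A) where

  dist²-triangle : ∀ q (χ φ ψ : A → ℂ) →
    (fromℚ q *ᴿ dist² xs χ ψ) ≤ℝ
    (fromℚ (1ℚ ℚ.+ q) *ᴿ dist² xs χ φ +ᴿ fromℚ (q ℚ.* (1ℚ ℚ.+ q)) *ᴿ dist² xs φ ψ)
  dist²-triangle q χ φ ψ = ∑-mono-combination (fromℚ q) _ _ xs λ x → begin
    fromℚ q *ᴿ ∣ χ x +ᶜ -ᶜ ψ x ∣²
      ≈⟨ R.*-congˡ (∣∣²-cong (sub-trans-ℂ (χ x) (φ x) (ψ x))) ⟨
    fromℚ q *ᴿ ∣ (χ x +ᶜ -ᶜ φ x) +ᶜ (φ x +ᶜ -ᶜ ψ x) ∣²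
      ≲⟨ peter-paul q (χ x +ᶜ -ᶜ φ x) (φ x +ᶜ -ᶜ ψ x) ⟩
    fromℚ (1ℚ ℚ.+ q) *ᴿ ∣ χ x +ᶜ -ᶜ φ x ∣² +ᴿ fromℚ (q ℚ.* (1ℚ ℚ.+ q)) *ᴿ ∣ φ x +ᶜ -ᶜ ψ x ∣²
      ∎
    where open import Relation.Binary.Reasoning.Preorder ≤ℝ-preorder

  -- The weight must exceed 1 to be of use. If φ has mass at least 2/3 on an outcome and ψ at most
  -- 1/3, weight `q` yields a squared distance of at least (q - 1)/(3q(q + 1)): nothing for q = 1,
  -- and 1/18 for the choice q = 2.
  norm²-perturb : ∀ (φ ψ : A → ℂ) →
    (fromℚ 2ℚ *ᴿ norm² xs φ) ≤ℝ (fromℚ 3ℚ *ᴿ norm² xs ψ +ᴿ fromℚ 6ℚ *ᴿ dist² xs φ ψ)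
  norm²-perturb φ ψ = ∑-mono-combination (fromℚ 2ℚ) _ _ xs λ x → begin
    fromℚ 2ℚ *ᴿ ∣ φ x ∣²                         ≈⟨ R.*-congˡ (∣∣²-cong (add-sub-ℂ (φ x) (ψ x))) ⟨
    fromℚ 2ℚ *ᴿ ∣ ψ x +ᶜ (φ x +ᶜ -ᶜ ψ x) ∣²    ≲⟨ peter-paul 2ℚ (ψ x) (φ x +ᶜ -ᶜ ψ x) ⟩
    fromℚ 3ℚ *ᴿ ∣ ψ x ∣² +ᴿ fromℚ 6ℚ *ᴿ ∣ φ x +ᶜ -ᶜ ψ x ∣²  ∎
    where open import Relation.Binary.Reasoning.Preorder ≤ℝ-preorder

∣-∣²-parallelogram : ∀ w z → ∣ w +ᶜ -ᶜ z ∣² ≤ℝ (fromℚ 2ℚ *ᴿ ∣ w ∣² +ᴿ fromℚ 2ℚ *ᴿ ∣ z ∣²)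
∣-∣²-parallelogram w z = begin
  ∣ w +ᶜ -ᶜ z ∣²                                ≈⟨ R.*-identityˡ _ ⟨
  1ᴿ *ᴿ ∣ w +ᶜ -ᶜ z ∣²                          ≲⟨ peter-paul 1ℚ w (-ᶜ z) ⟩
  fromℚ 2ℚ *ᴿ ∣ w ∣² +ᴿ fromℚ 2ℚ *ᴿ ∣ -ᶜ z ∣²     ≈⟨ R.+-congˡ (R.*-congˡ (∣-z∣² z)) ⟩
  fromℚ 2ℚ *ᴿ ∣ w ∣² +ᴿ fromℚ 2ℚ *ᴿ ∣ z ∣²        ∎
  where open import Relation.Binary.Reasoning.Preorder ≤ℝ-preorder

dist²-self : ∀ {A : Set} xs (ψ : A → ℂ) → dist² xs ψ ψ ≈ℝ 0ᴿ
dist²-self xs ψ = R.trans (norm²-cong xs (λ x → C.-‿inverseʳ (ψ x)))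
  (R.trans (∑R.∑-cong xs (λ _ → pointwise (λ _ → refl))) (∑R.∑-0# xs))

-- Unitary operators and oracles

conj-0ᶜ : conj 0ᶜ ≈ℂ 0ᶜ
conj-0ᶜ = boxℂ (pointwise-≈ᶜ (conj 0ᶜ) 0ᶜ (λ _ → refl) (λ _ → refl))

conj-+ᶜ : ∀ w z → conj (w +ᶜ z) ≈ℂ conj w +ᶜ conj z
conj-+ᶜ w z = boxℂ (pointwise-≈ᶜ (conj (w +ᶜ z)) (conj w +ᶜ conj z) (λ _ → refl)
                     (λ n → ℚ.neg-distrib-+ (seq (im w) n) (seq (im z) n)))

conj-*ᶜ : ∀ w z → conj (w *ᶜ z) ≈ℂ conj w *ᶜ conj z
conj-*ᶜ w z = boxℂ (pointwise-≈ᶜ (conj (w *ᶜ z)) (conj w *ᶜ conj z)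
  (λ n → re-conj-*′ (seq (re w) n) (seq (im w) n) (seq (re z) n) (seq (im z) n))
  (λ n → im-conj-* (seq (re w) n) (seq (im w) n) (seq (re z) n) (seq (im z) n)))

module _ {n b W : ℕ} where

  basis-unique : Unique (basis {n} {b} {W})
  basis-unique = Unique.cartesianProduct⁺ (Unique.allFin⁺ n)
                   (Unique.cartesianProduct⁺ (bitStrings-unique b) (Unique.allFin⁺ W))

  ∈-basis : ∀ (x : Basis n b W) → x ∈ basis
  ∈-basis (i , c , w) = ∈-cartesianProduct⁺ (∈-allFin i)
                          (∈-cartesianProduct⁺ (∈-bitStrings c) (∈-allFin w))

  ·-sub : ∀ (M : Operator {n} {b} {W}) φ ψ x →
          (M · φ) x +ᶜ -ᶜ (M · ψ) x ≈ℂ (M · (λ y → φ y +ᶜ -ᶜ ψ y)) x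
  ·-sub M φ ψ x = begin
    (M · φ) x +ᶜ -ᶜ (M · ψ) x
      ≈⟨ C.+-congˡ {(M · φ) x} (∑C.∑-neg basis (λ y → M x y *ᶜ ψ y)) ⟨
    ∑ᶜ basis (λ y → M x y *ᶜ φ y) +ᶜ ∑ᶜ basis (λ y → -ᶜ (M x y *ᶜ ψ y))
      ≈⟨ ∑C.∑-+ basis (λ y → M x y *ᶜ φ y) (λ y → -ᶜ (M x y *ᶜ ψ y)) ⟨
    ∑ᶜ basis (λ y → M x y *ᶜ φ y +ᶜ -ᶜ (M x y *ᶜ ψ y))
      ≈⟨ ∑C.∑-cong basis (λ y → C.trans (C.+-congˡ (-‿distribʳ-* (M x y) (ψ y)))
                                        (C.sym (C.distribˡ (M x y) _ _))) ⟩
    (M · (λ y → φ y +ᶜ -ᶜ ψ y)) x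
      ∎
    where
    open import Algebra.Properties.Ring C.ring using (-‿distribʳ-*)
    open import Relation.Binary.Reasoning.Setoid C.setoid

  norm²-unitary : ∀ (V : Unitary n b W) ψ → norm² basis (operator V · ψ) ≈ℝ norm² basis ψ
  norm²-unitary V ψ = R.trans (R.sym (re-∑-conj-* basis (operator V · ψ)))
    (R.trans (boxℝ (proj₁ (unboxℂ
               (∑C.isometry conj conj-0ᶜ conj-+ᶜ conj-*ᶜ _≟ᴮ_ basis-unique ∈-basis (operator V)
                 (λ y z → boxℂ (proj₁ (isUnitary V) y z)) ψ))))
             (re-∑-conj-* basis ψ))

  dist²-unitary : ∀ (V : Unitary n b W) φ ψ →
    dist² basis (operator V · φ) (operator V · ψ) ≈ℝ dist² basis φ ψ
  dist²-unitary V φ ψ = R.trans (norm²-cong basis (·-sub (operator V) φ ψ)) (norm²-unitary V _)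

  module _ {σ : ℕ} (s : Str σ n) where

    shift : Basis n b W → Basis n b W
    shift (i , c , w) = i , c ⊕ binary b (toℕ (lookup s i)) , w

    shift-involutive : ∀ x → shift (shift x) ≡ x
    shift-involutive (i , c , w) = cong (λ d → i , d , w) (⊕-involutive c _)

    -- The oracle is the permutation matrix of `shift`. XOR with a fixed string undoes itself, so
    -- the amplitude arriving at `x` comes from `shift s x`, and applying an oracle is a mere
    -- relabelling.
    oracle-· : ∀ ψ x → (oracle s · ψ) x ≈ℂ ψ (shift x)
    oracle-· ψ x = C.trans
      (∑C.∑-cong basis (λ y →
        C.reflexive (cong (_*ᶜ ψ y) (∑C.δ-involution _≟ᴮ_ {shift} shift-involutive x y))))
      (∑C.∑-δ _≟ᴮ_ ψ basis-unique (∈-basis (shift x)))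

    ∑-shift : ∀ f → ∑ᴿ basis (λ x → f (shift x)) ≈ℝ ∑ᴿ basis f
    ∑-shift f = ∑R.∑-involution _≟ᴮ_ {shift} shift-involutive f basis-unique ∈-basis

    norm²-oracle : ∀ ψ → norm² basis (oracle s · ψ) ≈ℝ norm² basis ψ
    norm²-oracle ψ = R.trans (norm²-cong basis (oracle-· ψ)) (∑-shift (λ x → ∣ ψ x ∣²))

    dist²-oracle : ∀ φ ψ → dist² basis (oracle s · φ) (oracle s · ψ) ≈ℝ dist² basis φ ψ
    dist²-oracle φ ψ = R.trans
      (norm²-cong basis (λ x → C.+-cong (oracle-· φ x) (C.-‿cong (oracle-· ψ x))))
      (∑-shift (λ x → ∣ φ x +ᶜ -ᶜ ψ x ∣²))

-- Natural numbers as rationals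

-- By this recursion `ι (suc (suc t))` is `1ℚ ℚ.+ ι (suc t)` by definition, which is how the weights
-- grow from one step of a run to the next.
ι : ℕ → ℚ
ι zero    = 0ℚ
ι (suc n) = 1ℚ ℚ.+ ι n

0≤ι : ∀ n → 0ℚ ℚ.≤ ι n
0<ι : ∀ n → 0ℚ ℚ.< ι (suc n)
0≤ι zero    = ℚ.≤-refl
0≤ι (suc n) = ℚ.<⇒≤ (0<ι n)
0<ι n = ℚ.+-mono-<-≤ (ℚ.positive⁻¹ 1ℚ) (0≤ι n)

ι-+ : ∀ m n → ι (m ℕ.+ n) ≡ ι m ℚ.+ ι n
ι-+ zero    n = ≡.sym (ℚ.+-identityˡ (ι n))
ι-+ (suc m) n = ≡.trans (cong (1ℚ ℚ.+_) (ι-+ m n)) (≡.sym (ℚ.+-assoc 1ℚ (ι m) (ι n)))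

ι-* : ∀ m n → ι (m ℕ.* n) ≡ ι m ℚ.* ι n
ι-* zero    n = ≡.sym (ℚ.*-zeroˡ (ι n))
ι-* (suc m) n = ≡.trans (ι-+ n (m ℕ.* n))
  (≡.trans (cong₂ ℚ._+_ (≡.sym (ℚ.*-identityˡ (ι n))) (ι-* m n))
           (≡.sym (ℚ.*-distribʳ-+ (ι n) 1ℚ (ι m))))

ι-cancel-≤ : ∀ m n → ι m ℚ.≤ ι n → m ℕ.≤ n
ι-cancel-≤ zero    n       _   = z≤n
ι-cancel-≤ (suc m) zero    m≤n = contradiction (ℚ.<-≤-trans (0<ι m) m≤n) (ℚ.<-irrefl refl)
ι-cancel-≤ (suc m) (suc n) m≤n =
  s≤s (ι-cancel-≤ m n (≡.subst₂ ℚ._≤_ (cancel (ι m)) (cancel (ι n)) (ℚ.+-monoʳ-≤ (ℚ.- 1ℚ) m≤n)))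
  where
  open +-*-Solver
  cancel : ∀ p → ℚ.- 1ℚ ℚ.+ (1ℚ ℚ.+ p) ≡ p
  cancel = solve 1 (λ p → con (ℚ.- 1ℚ) :+ (con 1ℚ :+ p) := p) refl

-- Without queries the hypothesis contradicts 1 ≤ m. Otherwise 72T(T + 1) + 1 is at most 145T², well
-- within 17² = 289 times T². In terms of the predecessor of the number of queries, the difference
-- is the polynomial with coefficients 217, 362 and 144.
quadratic⇒≤ : ∀ m T → 1 ℕ.≤ m → m ℕ.≤ 18 ℕ.* (suc T ℕ.* (T ℕ.* 4)) → suc m ℕ.≤ (17 ℕ.* T) ℕ.^ 2
quadratic⇒≤ (suc m) zero    _ ()
quadratic⇒≤ m       (suc T) _ m≤ = begin
  suc m                                                  ≤⟨ s≤s m≤ ⟩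
  suc (18 ℕ.* (suc (suc T) ℕ.* (suc T ℕ.* 4)))            ≤⟨ ℕ.m≤m+n _ _ ⟩
  suc (18 ℕ.* (suc (suc T) ℕ.* (suc T ℕ.* 4))) ℕ.+ (217 ℕ.* (T ℕ.* T) ℕ.+ 362 ℕ.* T ℕ.+ 144)
    ≡⟨ expand T ⟩
  (17 ℕ.* suc T) ℕ.* (17 ℕ.* suc T)                      ≡⟨ cong ((17 ℕ.* suc T) ℕ.*_) (ℕ.*-identityʳ _) ⟨
  (17 ℕ.* suc T) ℕ.^ 2                                   ∎
  where
  open ℕ.≤-Reasoning
  open ℕ.+-*-Solver
  expand : ∀ T → suc (18 ℕ.* (suc (suc T) ℕ.* (suc T ℕ.* 4))) ℕ.+ (217 ℕ.* (T ℕ.* T) ℕ.+ 362 ℕ.* T ℕ.+ 144)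
               ≡ (17 ℕ.* suc T) ℕ.* (17 ℕ.* suc T)
  expand = solve 1 (λ T →
    con 1 :+ con 18 :* ((con 2 :+ T) :* ((con 1 :+ T) :* con 4))
      :+ (con 217 :* (T :* T) :+ con 362 :* T :+ con 144)
    := (con 17 :* (con 1 :+ T)) :* (con 17 :* (con 1 :+ T))) refl

-- The hybrid argument

open import Relation.Binary.Reasoning.Preorder ≤ℝ-preorder

4ℚ : ℚ
4ℚ = 2ℚ ℚ.+ 2ℚ

0≤ℝ∣∣² : ∀ z → 0ᴿ ≤ℝ ∣ z ∣²
0≤ℝ∣∣² z = pointwise-≤ (0≤∣∣² z)

≤ℝ-reflexive : ∀ {x y} → x ≈ℝ y → x ≤ℝ y
≤ℝ-reflexive {x} {y} x≈y = begin x ≈⟨ x≈y ⟩ y ∎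

fromℚ-+ : ∀ p q → fromℚ p +ᴿ fromℚ q ≈ℝ fromℚ (p ℚ.+ q)
fromℚ-+ p q = pointwise (λ _ → refl)

module _ {n b W : ℕ} where

  -- The query magnitude: for a normalised state, the probability that measuring the index register
  -- gives `k`. With `δ` as a factor, summing over `k` is an exchange of sums.
  mass : Fin n → State {n} {b} {W} → ℝ
  mass k φ = ∑ᴿ basis (λ x → ∑R.δ Fin._≟_ k (proj₁ x) *ᴿ ∣ φ x ∣²)

  -- Away from index `k` the two relabellings agree and the amplitudes cancel. At index `k` the
  -- squared difference is at most twice the sum of the two squared moduli. Both relabellings keep
  -- the index, so each half reindexes to 2 `mass k φ`.
  oracle-difference : ∀ {m} k (φ : State {n} {b} {W}) →
    dist² basis (oracle (marked {m} k) · φ) (oracle (blank {m} n) · φ) ≤ℝ fromℚ 4ℚ *ᴿ mass k φ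
  oracle-difference {m} k φ = begin
    dist² basis (oracle s · φ) (oracle s₀ · φ)
      ≈⟨ norm²-cong basis (λ x → C.+-cong (oracle-· s φ x) (C.-‿cong (oracle-· s₀ φ x))) ⟩
    norm² basis (λ x → φ (shift s x) +ᶜ -ᶜ φ (shift s₀ x))
      ≈⟨ R.*-identityˡ _ ⟨
    1ᴿ *ᴿ norm² basis (λ x → φ (shift s x) +ᶜ -ᶜ φ (shift s₀ x))
      ≲⟨ ∑-mono-combination 1ᴿ (fromℚ 2ℚ) (fromℚ 2ℚ) basis
           (λ x → bound x (k Fin.≟ proj₁ x)) ⟩
    fromℚ 2ℚ *ᴿ ∑ᴿ basis (λ x → weight (shift s x)) +ᴿ fromℚ 2ℚ *ᴿ ∑ᴿ basis (λ x → weight (shift s₀ x))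
      ≈⟨ R.+-cong (R.*-congˡ {fromℚ 2ℚ} (∑-shift s weight)) (R.*-congˡ {fromℚ 2ℚ} (∑-shift s₀ weight)) ⟩
    fromℚ 2ℚ *ᴿ mass k φ +ᴿ fromℚ 2ℚ *ᴿ mass k φ
      ≈⟨ R.distribʳ (mass k φ) (fromℚ 2ℚ) (fromℚ 2ℚ) ⟨
    (fromℚ 2ℚ +ᴿ fromℚ 2ℚ) *ᴿ mass k φ
      ≈⟨ R.*-congʳ {mass k φ} (fromℚ-+ 2ℚ 2ℚ) ⟩
    fromℚ 4ℚ *ᴿ mass k φ
      ∎
    where
    s s₀ : Str (suc (suc m)) n
    s  = marked k
    s₀ = blank n

    weight : Basis n b W → ℝ
    weight x = ∑R.δ Fin._≟_ k (proj₁ x) *ᴿ ∣ φ x ∣²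

    bound : ∀ x → Dec (k ≡ proj₁ x) →
      1ᴿ *ᴿ ∣ φ (shift s x) +ᶜ -ᶜ φ (shift s₀ x) ∣² ≤ℝ
      fromℚ 2ℚ *ᴿ weight (shift s x) +ᴿ fromℚ 2ℚ *ᴿ weight (shift s₀ x)
    bound x (yes k≡i) = begin
      1ᴿ *ᴿ ∣ φ (shift s x) +ᶜ -ᶜ φ (shift s₀ x) ∣²
        ≈⟨ R.*-identityˡ _ ⟩
      ∣ φ (shift s x) +ᶜ -ᶜ φ (shift s₀ x) ∣²
        ≲⟨ ∣-∣²-parallelogram (φ (shift s x)) (φ (shift s₀ x)) ⟩
      fromℚ 2ℚ *ᴿ ∣ φ (shift s x) ∣² +ᴿ fromℚ 2ℚ *ᴿ ∣ φ (shift s₀ x) ∣²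
        ≈⟨ R.+-cong (R.*-congˡ {fromℚ 2ℚ} (weight≈ (shift s x) k≡i))
                    (R.*-congˡ {fromℚ 2ℚ} (weight≈ (shift s₀ x) k≡i)) ⟨
      fromℚ 2ℚ *ᴿ weight (shift s x) +ᴿ fromℚ 2ℚ *ᴿ weight (shift s₀ x)
        ∎
      where
      weight≈ : ∀ y → k ≡ proj₁ y → weight y ≈ℝ ∣ φ y ∣²
      weight≈ y k≡ = R.trans (R.*-congʳ {∣ φ y ∣²} (∑R.δ-≡ Fin._≟_ k≡)) (R.*-identityˡ _)
    bound x (no k≢i) = begin
      1ᴿ *ᴿ ∣ φ (shift s x) +ᶜ -ᶜ φ (shift s₀ x) ∣²
        ≈⟨ R.*-identityˡ _ ⟩
      ∣ φ (shift s x) +ᶜ -ᶜ φ (shift s₀ x) ∣²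
        ≈⟨ ∣∣²-cong (C.trans (C.reflexive (cong (λ y → φ y +ᶜ -ᶜ φ (shift s₀ x)) shift≡))
                             (C.-‿inverseʳ (φ (shift s₀ x)))) ⟩
      ∣ 0ᶜ ∣²
        ≈⟨ pointwise (λ _ → refl) ⟩
      fromℚ 2ℚ *ᴿ 0ᴿ +ᴿ fromℚ 2ℚ *ᴿ 0ᴿ
        ≈⟨ R.+-cong (R.*-congˡ {fromℚ 2ℚ} (weight≈ (shift s x) k≢i))
                    (R.*-congˡ {fromℚ 2ℚ} (weight≈ (shift s₀ x) k≢i)) ⟨
      fromℚ 2ℚ *ᴿ weight (shift s x) +ᴿ fromℚ 2ℚ *ᴿ weight (shift s₀ x)
        ∎
      where
      weight≈ : ∀ y → k ≢ proj₁ y → weight y ≈ℝ 0ᴿ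
      weight≈ y k≢ = R.trans (R.*-congʳ {∣ φ y ∣²} (∑R.δ-≢ Fin._≟_ k≢)) (R.zeroˡ _)

      shift≡ : shift s x ≡ shift s₀ x
      shift≡ = cong (λ c → proj₁ x , proj₁ (proj₂ x) ⊕ binary b (toℕ c) , proj₂ (proj₂ x))
                 (lookup-marked k (proj₁ x) (λ i≡k → k≢i (≡.sym i≡k)))

-- An index is charged to the one mark that sits on it, and index `zero` to none, since the marks
-- are the successors; hence an inequality.
∑-δ-suc : ∀ {m} (i : Fin (suc m)) {a} → 0ᴿ ≤ℝ a →
  ∑ᴿ (allFin m) (λ j → ∑R.δ Fin._≟_ (suc j) i *ᴿ a) ≤ℝ a
∑-δ-suc {m} zero {a} 0≤a = begin
  ∑ᴿ (allFin m) (λ _ → 0ᴿ *ᴿ a)  ≈⟨ ∑R.∑-cong (allFin m) (λ _ → R.zeroˡ a) ⟩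
  ∑ᴿ (allFin m) (λ _ → 0ᴿ)       ≈⟨ ∑R.∑-0# (allFin m) ⟩
  0ᴿ                             ≲⟨ 0≤a ⟩
  a                              ∎
∑-δ-suc {m} (suc i) {a} 0≤a = begin
  ∑ᴿ (allFin m) (λ j → ∑R.δ Fin._≟_ j i *ᴿ a)
    ≈⟨ ∑R.∑-cong (allFin m) (λ j → R.reflexive (cong (_*ᴿ a) (∑R.δ-sym Fin._≟_ j i))) ⟩
  ∑ᴿ (allFin m) (λ j → ∑R.δ Fin._≟_ i j *ᴿ a)
    ≈⟨ ∑R.∑-δ Fin._≟_ (λ _ → a) (Unique.allFin⁺ m) (∈-allFin i) ⟩
  a ∎

∑-mass : ∀ {m b W} (φ : State {suc m} {b} {W}) →
  ∑ᴿ (allFin m) (λ j → mass (suc j) φ) ≤ℝ norm² basis φ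
∑-mass {m} φ = begin
  ∑ᴿ (allFin m) (λ j → ∑ᴿ basis (λ x → ∑R.δ Fin._≟_ (suc j) (proj₁ x) *ᴿ ∣ φ x ∣²))
    ≈⟨ ∑R.∑-swap (allFin m) basis (λ j x → ∑R.δ Fin._≟_ (suc j) (proj₁ x) *ᴿ ∣ φ x ∣²) ⟩
  ∑ᴿ basis (λ x → ∑ᴿ (allFin m) (λ j → ∑R.δ Fin._≟_ (suc j) (proj₁ x) *ᴿ ∣ φ x ∣²))
    ≲⟨ ∑-mono basis (λ x → ∑-δ-suc (proj₁ x) (0≤ℝ∣∣² (φ x))) ⟩
  norm² basis φ ∎

private module ℚ-hybrid where
  open +-*-Solver

  factor : ∀ q c e → (1ℚ ℚ.+ q) ℚ.* (q ℚ.* c) ℚ.+ (q ℚ.* (1ℚ ℚ.+ q)) ℚ.* e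
                     ≡ q ℚ.* ((1ℚ ℚ.+ q) ℚ.* (c ℚ.+ e))
  factor = solve 3 (λ q c e → (con 1ℚ :+ q) :* (q :* c) :+ (q :* (con 1ℚ :+ q)) :* e
                              := q :* ((con 1ℚ :+ q) :* (c :+ e))) refl

open ℚ-hybrid

module _ {m n b W : ℕ} where

  step : Str (suc (suc m)) n → State {n} {b} {W} → Unitary n b W → State {n} {b} {W}
  step s ψ V = operator V · oracle s · ψ

  run : ∀ {T} → Str (suc (suc m)) n → State {n} {b} {W} → Vec (Unitary n b W) T →
        State {n} {b} {W}
  run s = Vec.foldl′ (step s)

  norm²-step : ∀ s ψ V → norm² basis (step s ψ V) ≈ℝ norm² basis ψ
  norm²-step s ψ V = R.trans (norm²-unitary V (oracle s · ψ)) (norm²-oracle s ψ)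

  norm²-run : ∀ {T} s ψ (Vs : Vec (Unitary n b W) T) →
    norm² basis (run s ψ Vs) ≈ℝ norm² basis ψ
  norm²-run s ψ []       = R.refl
  norm²-run s ψ (V ∷ Vs) = R.trans (norm²-run s (step s ψ V) Vs) (norm²-step s ψ V)

  -- In every step both oracles act on the same state, that of the run on `s₀`. This state is
  -- independent of `s`, which is what allows the errors of all marked strings to be added up
  -- against a single run.
  discrepancy : ∀ {T} (s s₀ : Str (suc (suc m)) n) → State {n} {b} {W} →
                Vec (Unitary n b W) T → ℝ
  discrepancy s s₀ φ []       = 0ᴿ
  discrepancy s s₀ φ (V ∷ Vs) =
    dist² basis (oracle s · φ) (oracle s₀ · φ) +ᴿ discrepancy s s₀ (step s₀ φ V) Vs

  -- Weighting the triangle inequality by the number of steps made so far turns the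
  -- Cauchy–Schwarz bound (Σ √eᵢ)² ≤ T Σ eᵢ into an induction without square roots.
  dist²-run : ∀ {T} t s s₀ c ψ φ (Vs : Vec (Unitary n b W) T) →
    dist² basis ψ φ ≤ℝ fromℚ (ι (suc t)) *ᴿ c →
    dist² basis (run s ψ Vs) (run s₀ φ Vs)
      ≤ℝ fromℚ (ι (T ℕ.+ suc t)) *ᴿ (c +ᴿ discrepancy s s₀ φ Vs)
  dist²-run t s s₀ c ψ φ [] ψ≈φ = begin
    dist² basis ψ φ                    ≲⟨ ψ≈φ ⟩
    fromℚ (ι (suc t)) *ᴿ c             ≈⟨ R.*-congˡ {fromℚ (ι (suc t))} (R.+-identityʳ c) ⟨
    fromℚ (ι (suc t)) *ᴿ (c +ᴿ 0ᴿ)     ∎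
  dist²-run {suc T} t s s₀ c ψ φ (V ∷ Vs) ψ≈φ = begin
    dist² basis (run s (step s ψ V) Vs) (run s₀ (step s₀ φ V) Vs)
      ≲⟨ dist²-run (suc t) s s₀ (c +ᴿ e) (step s ψ V) (step s₀ φ V) Vs stepped ⟩
    fromℚ (ι (T ℕ.+ suc (suc t))) *ᴿ ((c +ᴿ e) +ᴿ rest)
      ≈⟨ R.*-cong (R.reflexive (cong (λ k → fromℚ (ι k)) (ℕ.+-suc T (suc t)))) (R.+-assoc c e rest) ⟩
    fromℚ (ι (suc T ℕ.+ suc t)) *ᴿ (c +ᴿ (e +ᴿ rest))
      ∎
    where
    q : ℚ
    q = ι (suc t)

    e rest : ℝ
    e    = dist² basis (oracle s · φ) (oracle s₀ · φ)
    rest = discrepancy s s₀ (step s₀ φ V) Vs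

    -- The triangle goes through `oracle s · φ`: the earlier error, at most qc, passes unchanged
    -- through the common oracle, and exchanging the oracle at `φ` costs `e`. The weights are such
    -- that (1 + q)qc + q(1 + q)e has the factor q, which cancels.
    stepped : dist² basis (step s ψ V) (step s₀ φ V) ≤ℝ fromℚ (1ℚ ℚ.+ q) *ᴿ (c +ᴿ e)
    stepped = *ᴿ-cancelˡ-≤ q (0<ι t) (begin
      fromℚ q *ᴿ dist² basis (step s ψ V) (step s₀ φ V)
        ≈⟨ R.*-congˡ {fromℚ q} (dist²-unitary V (oracle s · ψ) (oracle s₀ · φ)) ⟩
      fromℚ q *ᴿ dist² basis (oracle s · ψ) (oracle s₀ · φ)
        ≲⟨ dist²-triangle basis q (oracle s · ψ) (oracle s · φ) (oracle s₀ · φ) ⟩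
      fromℚ (1ℚ ℚ.+ q) *ᴿ dist² basis (oracle s · ψ) (oracle s · φ)
        +ᴿ fromℚ (q ℚ.* (1ℚ ℚ.+ q)) *ᴿ e
        ≈⟨ R.+-congʳ {fromℚ (q ℚ.* (1ℚ ℚ.+ q)) *ᴿ e}
             (R.*-congˡ {fromℚ (1ℚ ℚ.+ q)} (dist²-oracle s ψ φ)) ⟩
      fromℚ (1ℚ ℚ.+ q) *ᴿ dist² basis ψ φ +ᴿ fromℚ (q ℚ.* (1ℚ ℚ.+ q)) *ᴿ e
        ≲⟨ +ᴿ-mono-≤ (*ᴿ-monoʳ-≤ (1ℚ ℚ.+ q) (0<ι (suc t)) ψ≈φ) (≤ℝ-reflexive R.refl) ⟩
      fromℚ (1ℚ ℚ.+ q) *ᴿ (fromℚ q *ᴿ c) +ᴿ fromℚ (q ℚ.* (1ℚ ℚ.+ q)) *ᴿ e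
        ≈⟨ pointwise (λ k → factor q (seq c k) (seq e k)) ⟩
      fromℚ q *ᴿ (fromℚ (1ℚ ℚ.+ q) *ᴿ (c +ᴿ e)) ∎)

-- Every query weight is charged to a single mark, so the total over all marks is at most
-- a constant per query.
∑-discrepancy : ∀ {c m b W T} (φ : State {suc m} {b} {W}) (Vs : Vec (Unitary (suc m) b W) T) →
  ∑ᴿ (allFin m) (λ j → discrepancy (marked {c} (suc j)) (blank (suc m)) φ Vs)
    ≤ℝ fromℚ (ι T) *ᴿ (fromℚ 4ℚ *ᴿ norm² basis φ)
∑-discrepancy {m = m} φ [] = begin
  ∑ᴿ (allFin m) (λ _ → 0ᴿ)              ≈⟨ ∑R.∑-0# (allFin m) ⟩
  0ᴿ                                    ≈⟨ R.zeroˡ _ ⟨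
  0ᴿ *ᴿ (fromℚ 4ℚ *ᴿ norm² basis φ)     ∎
∑-discrepancy {c} {m} {T = suc T} φ (V ∷ Vs) = begin
  ∑ᴿ (allFin m) (λ j → e j +ᴿ rest j)
    ≈⟨ ∑R.∑-+ (allFin m) e rest ⟩
  ∑ᴿ (allFin m) e +ᴿ ∑ᴿ (allFin m) rest
    ≲⟨ +ᴿ-mono-≤ first (∑-discrepancy {c} φ′ Vs) ⟩
  x +ᴿ fromℚ (ι T) *ᴿ (fromℚ 4ℚ *ᴿ norm² basis φ′)
    ≈⟨ R.+-congˡ {x} (R.*-congˡ {fromℚ (ι T)} (R.*-congˡ {fromℚ 4ℚ} (norm²-step s₀ φ V))) ⟩
  x +ᴿ fromℚ (ι T) *ᴿ x
    ≈⟨ y+qy x ⟩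
  fromℚ (1ℚ ℚ.+ ι T) *ᴿ x
    ∎
  where
  s₀ : Str (suc (suc c)) (suc m)
  s₀ = blank (suc m)

  φ′ : State {suc m}
  φ′ = step s₀ φ V

  x : ℝ
  x = fromℚ 4ℚ *ᴿ norm² basis φ

  y+qy : ∀ y → y +ᴿ fromℚ (ι T) *ᴿ y ≈ℝ fromℚ (1ℚ ℚ.+ ι T) *ᴿ y
  y+qy y = R.trans (R.+-congʳ (R.sym (R.*-identityˡ y)))
    (R.trans (R.sym (R.distribʳ y 1ᴿ (fromℚ (ι T)))) (R.*-congʳ {y} (fromℚ-+ 1ℚ (ι T))))

  e rest : Fin m → ℝ
  e j    = dist² basis (oracle (marked {c} (suc j)) · φ) (oracle s₀ · φ)
  rest j = discrepancy (marked {c} (suc j)) s₀ φ′ Vs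

  first : ∑ᴿ (allFin m) e ≤ℝ fromℚ 4ℚ *ᴿ norm² basis φ
  first = begin
    ∑ᴿ (allFin m) e
      ≲⟨ ∑-mono (allFin m) (λ j → oracle-difference {m = c} (suc j) φ) ⟩
    ∑ᴿ (allFin m) (λ j → fromℚ 4ℚ *ᴿ mass (suc j) φ)
      ≈⟨ ∑R.*-distribˡ-∑ (fromℚ 4ℚ) (allFin m) (λ j → mass (suc j) φ) ⟨
    fromℚ 4ℚ *ᴿ ∑ᴿ (allFin m) (λ j → mass (suc j) φ)
      ≲⟨ *ᴿ-monoʳ-≤ 4ℚ (ℚ.positive⁻¹ 4ℚ) (∑-mass φ) ⟩
    fromℚ 4ℚ *ᴿ norm² basis φ ∎

-- Distinguishing outcomes

norm²-ket : ∀ {n b W} (y : Basis n b W) → norm² basis (ket y) ≈ℝ 1ᴿ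
norm²-ket y = R.trans
  (∑R.∑-cong basis (λ x → R.trans (∣if∣² (does (x ≟ᴮ y)))
    (R.reflexive (cong (_*ᴿ 1ᴿ) (∑R.δ-sym _≟ᴮ_ x y)))))
  (∑R.∑-δ _≟ᴮ_ (λ _ → 1ᴿ) basis-unique (∈-basis y))
  where
  ∣if∣² : ∀ d → ∣ if d then 1ᶜ else 0ᶜ ∣² ≈ℝ (if d then 1ᴿ else 0ᴿ) *ᴿ 1ᴿ
  ∣if∣² true  = pointwise (λ _ → refl)
  ∣if∣² false = pointwise (λ _ → refl)

norm²-initial : ∀ {n b W} (V : Unitary n b W) y → norm² basis (operator V · ket y) ≈ℝ 1ᴿ
norm²-initial V y = R.trans (norm²-unitary V (ket y)) (norm²-ket y)

module _ {A : Set} {P : A → Set} (P? : ∀ x → Dec (P x)) where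

  ∑-filter-≤ : ∀ xs (f : A → ℝ) → (∀ x → 0ᴿ ≤ℝ f x) → ∑ᴿ (filter P? xs) f ≤ℝ ∑ᴿ xs f
  ∑-filter-≤ xs f 0≤f = begin
    ∑ᴿ (filter P? xs) f                                  ≈⟨ ∑R.∑-filter P? xs f ⟩
    ∑ᴿ xs (λ x → if does (P? x) then f x else 0ᴿ)        ≲⟨ ∑-mono xs (λ x → if-≤ (does (P? x)) (0≤f x)) ⟩
    ∑ᴿ xs f                                              ∎
    where
    if-≤ : ∀ d {y} → 0ᴿ ≤ℝ y → (if d then y else 0ᴿ) ≤ℝ y
    if-≤ true  0≤y = ≤ℝ-reflexive R.refl
    if-≤ false 0≤y = 0≤y

  ∑-filter-disjoint : ∀ {Q : A → Set} (Q? : ∀ x → Dec (Q x)) → (∀ x → P x → Q x → ⊥) →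
    ∀ xs (f : A → ℝ) → (∀ x → 0ᴿ ≤ℝ f x) →
    ∑ᴿ (filter P? xs) f +ᴿ ∑ᴿ (filter Q? xs) f ≤ℝ ∑ᴿ xs f
  ∑-filter-disjoint Q? disjoint xs f 0≤f = begin
    ∑ᴿ (filter P? xs) f +ᴿ ∑ᴿ (filter Q? xs) f
      ≈⟨ R.+-cong (∑R.∑-filter P? xs f) (∑R.∑-filter Q? xs f) ⟩
    ∑ᴿ xs (λ x → if does (P? x) then f x else 0ᴿ) +ᴿ ∑ᴿ xs (λ x → if does (Q? x) then f x else 0ᴿ)
      ≈⟨ ∑R.∑-+ xs _ _ ⟨
    ∑ᴿ xs (λ x → (if does (P? x) then f x else 0ᴿ) +ᴿ (if does (Q? x) then f x else 0ᴿ))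
      ≲⟨ ∑-mono xs (λ x → ifs-≤ (P? x) (Q? x) (disjoint x) (0≤f x)) ⟩
    ∑ᴿ xs f
      ∎
    where
    ifs-≤ : ∀ {P Q : Set} (P? : Dec P) (Q? : Dec Q) {y} → (P → Q → ⊥) → 0ᴿ ≤ℝ y →
      (if does P? then y else 0ᴿ) +ᴿ (if does Q? then y else 0ᴿ) ≤ℝ y
    ifs-≤ (yes p) (yes q) disj 0≤y = ⊥-elim (disj p q)
    ifs-≤ (yes p) (no _)  disj 0≤y = ≤ℝ-reflexive (R.+-identityʳ _)
    ifs-≤ (no _)  (yes q) disj 0≤y = ≤ℝ-reflexive (R.+-identityˡ _)
    ifs-≤ (no _)  (no _)  disj 0≤y = begin
      0ᴿ +ᴿ 0ᴿ  ≈⟨ R.+-identityʳ 0ᴿ ⟩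
      0ᴿ        ≲⟨ 0≤y ⟩
      _         ∎

dist²-sym : ∀ {A : Set} xs (φ ψ : A → ℂ) → dist² xs φ ψ ≈ℝ dist² xs ψ φ
dist²-sym xs φ ψ = ∑R.∑-cong xs (λ x → pointwise (λ n → cong₂ ℚ._+_
  (sub-square (seq (re (φ x)) n) (seq (re (ψ x)) n))
  (sub-square (seq (im (φ x)) n) (seq (im (ψ x)) n))))
  where
  open +-*-Solver
  sub-square : ∀ p q → (p ℚ.- q) ℚ.* (p ℚ.- q) ≡ (q ℚ.- p) ℚ.* (q ℚ.- p)
  sub-square = solve 2 (λ p q → (p :- q) :* (p :- q) := (q :- p) :* (q :- p)) refl

⅔ 9ℚ 18ℚ : ℚ
⅔ = + 2 ℚ./ 3
9ℚ = ι 9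
18ℚ = ι 18

-- If φ yields outcome k and ψ another outcome l with probability at least 2/3, then ψ
-- yields k with probability at most 1/3.
distinguish : ∀ {A : Set} (xs : List A) (out : A → ℕ) k l → k ≢ l → (φ ψ : A → ℂ) →
  norm² xs ψ ≈ℝ 1ᴿ →
  fromℚ ⅔ ≤ℝ norm² (filter (λ x → out x ℕ.≟ k) xs) φ →
  fromℚ ⅔ ≤ℝ norm² (filter (λ x → out x ℕ.≟ l) xs) ψ →
  1ᴿ ≤ℝ fromℚ 18ℚ *ᴿ dist² xs ψ φ
distinguish xs out k l k≢l φ ψ ‖ψ‖≈1 φ-k ψ-l = begin
  1ᴿ
    ≈⟨ pointwise (λ _ → refl) ⟩
  -- A linear combination of four inequalities: 6 times a ≥ 2/3, 9 times r ≥ 2/3, 3 times 2a ≤ 3d +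
  -- 6D′, and 9 times d + r ≤ 1. The multipliers eliminate a, d and r; what remains is -9 + 4 + 6 =
  -- 1 on the left and 18D′ on the right.
  fromℚ (ℚ.- 9ℚ) +ᴿ (fromℚ 6ℚ *ᴿ fromℚ ⅔ +ᴿ fromℚ 9ℚ *ᴿ fromℚ ⅔)
    ≲⟨ +ᴿ-mono-≤ (≤ℝ-reflexive R.refl) (+ᴿ-mono-≤ (*ᴿ-monoʳ-≤ 6ℚ (ℚ.positive⁻¹ 6ℚ) φ-k)
                                                 (*ᴿ-monoʳ-≤ 9ℚ (ℚ.positive⁻¹ 9ℚ) ψ-l)) ⟩
  fromℚ (ℚ.- 9ℚ) +ᴿ (fromℚ 6ℚ *ᴿ a +ᴿ fromℚ 9ℚ *ᴿ r)
    ≈⟨ pointwise (λ n → split (seq a n) (seq r n)) ⟩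
  fromℚ (ℚ.- 9ℚ) +ᴿ (fromℚ 3ℚ *ᴿ (fromℚ 2ℚ *ᴿ a) +ᴿ fromℚ 9ℚ *ᴿ r)
    ≲⟨ +ᴿ-mono-≤ (≤ℝ-reflexive R.refl) (+ᴿ-mono-≤
         (*ᴿ-monoʳ-≤ 3ℚ (ℚ.positive⁻¹ 3ℚ) (norm²-perturb outcome-k φ ψ)) (≤ℝ-reflexive R.refl)) ⟩
  fromℚ (ℚ.- 9ℚ) +ᴿ (fromℚ 3ℚ *ᴿ (fromℚ 3ℚ *ᴿ d +ᴿ fromℚ 6ℚ *ᴿ D′) +ᴿ fromℚ 9ℚ *ᴿ r)
    ≈⟨ pointwise (λ n → regroup (seq d n) (seq D′ n) (seq r n)) ⟩
  fromℚ (ℚ.- 9ℚ) +ᴿ (fromℚ 9ℚ *ᴿ (d +ᴿ r) +ᴿ fromℚ 18ℚ *ᴿ D′)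
    ≲⟨ +ᴿ-mono-≤ (≤ℝ-reflexive R.refl) (+ᴿ-mono-≤
         (*ᴿ-monoʳ-≤ 9ℚ (ℚ.positive⁻¹ 9ℚ)
           (∑-filter-disjoint _ _ (λ x x≡k x≡l → k≢l (≡.trans (≡.sym x≡k) x≡l))
             xs _ (λ x → 0≤ℝ∣∣² (ψ x))))
         (*ᴿ-monoʳ-≤ 18ℚ (ℚ.positive⁻¹ 18ℚ)
           (∑-filter-≤ (λ x → out x ℕ.≟ k) xs _
             (λ x → 0≤ℝ∣∣² (φ x +ᶜ -ᶜ ψ x))))) ⟩
  fromℚ (ℚ.- 9ℚ) +ᴿ (fromℚ 9ℚ *ᴿ norm² xs ψ +ᴿ fromℚ 18ℚ *ᴿ dist² xs φ ψ)
    ≈⟨ R.+-congˡ {fromℚ (ℚ.- 9ℚ)} (R.+-cong (R.*-congˡ {fromℚ 9ℚ} ‖ψ‖≈1)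
                                            (R.*-congˡ {fromℚ 18ℚ} (dist²-sym xs φ ψ))) ⟩
  fromℚ (ℚ.- 9ℚ) +ᴿ (fromℚ 9ℚ *ᴿ 1ᴿ +ᴿ fromℚ 18ℚ *ᴿ dist² xs ψ φ)
    ≈⟨ pointwise (λ n → cancel (18ℚ ℚ.* seq (dist² xs ψ φ) n)) ⟩
  fromℚ 18ℚ *ᴿ dist² xs ψ φ ∎
  where
  open +-*-Solver
  outcome-k = filter (λ x → out x ℕ.≟ k) xs
  a d r D′ : ℝ
  a  = norm² outcome-k φ
  d  = norm² outcome-k ψ
  r  = norm² (filter (λ x → out x ℕ.≟ l) xs) ψ
  D′ = dist² outcome-k φ ψ

  split : ∀ a r → ℚ.- 9ℚ ℚ.+ (6ℚ ℚ.* a ℚ.+ 9ℚ ℚ.* r) ≡ ℚ.- 9ℚ ℚ.+ (3ℚ ℚ.* (2ℚ ℚ.* a) ℚ.+ 9ℚ ℚ.* r)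
  split = solve 2 (λ a r → con (ℚ.- 9ℚ) :+ (con 6ℚ :* a :+ con 9ℚ :* r)
                           := con (ℚ.- 9ℚ) :+ (con 3ℚ :* (con 2ℚ :* a) :+ con 9ℚ :* r)) refl

  regroup : ∀ d D r → ℚ.- 9ℚ ℚ.+ (3ℚ ℚ.* (3ℚ ℚ.* d ℚ.+ 6ℚ ℚ.* D) ℚ.+ 9ℚ ℚ.* r)
                      ≡ ℚ.- 9ℚ ℚ.+ (9ℚ ℚ.* (d ℚ.+ r) ℚ.+ 18ℚ ℚ.* D)
  regroup = solve 3 (λ d D r →
    con (ℚ.- 9ℚ) :+ (con 3ℚ :* (con 3ℚ :* d :+ con 6ℚ :* D) :+ con 9ℚ :* r)
    := con (ℚ.- 9ℚ) :+ (con 9ℚ :* (d :+ r) :+ con 18ℚ :* D)) refl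

  cancel : ∀ p → ℚ.- 9ℚ ℚ.+ (9ℚ ℚ.* 1ℚ ℚ.+ p) ≡ p
  cancel = solve 1 (λ p → con (ℚ.- 9ℚ) :+ (con 9ℚ :* con 1ℚ :+ p) := p) refl

-- Summation over all marks

∑-1 : ∀ {A : Set} (xs : List A) → ∑ᴿ xs (λ _ → 1ᴿ) ≈ℝ fromℚ (ι (length xs))
∑-1 []       = R.refl
∑-1 (x ∷ xs) = R.trans (R.+-congˡ {1ᴿ} (∑-1 xs)) (fromℚ-+ 1ℚ (ι (length xs)))

-- Each of the `m` marks contributes 1 on the left. On the right, 18 stems from `distinguish`, T + 1
-- from `dist²-run`, and 4T from `∑-discrepancy` for a state of norm 1.
query-bound : ∀ {c b m T} (A : Algorithm (suc m) b T) → SolvesLongestLyndon (suc (suc c)) A →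
  m ℕ.≤ 18 ℕ.* (suc T ℕ.* (T ℕ.* 4))
query-bound {c} {b} {m} {T} A solves =
  ι-cancel-≤ m _ (subst (ι m ℚ.≤_) (≡.sym ι-bound) (fromℚ-cancel-≤ bound))
  where
  s₀ : Str (suc (suc c)) (suc m)
  s₀ = blank (suc m)

  Vs = U A
  φ₀ : State {suc m} {b} {workDim A}
  φ₀ = operator (U₀ A) · ket (initial A)

  distance cost : Fin m → ℝ
  distance j = dist² basis (finalState A (marked {c} (suc j))) (finalState A s₀)
  cost j     = discrepancy (marked (suc j)) s₀ φ₀ Vs

  q : ℚ
  q = ι (T ℕ.+ 1)

  separated : ∀ j → 1ᴿ ≤ℝ fromℚ 18ℚ *ᴿ distance j
  -- The lengths differ because the mark is a successor, so its length is at least 2; a mark at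
  -- index `zero` would again give length 1.
  separated j = distinguish basis (output A) 1 (suc (toℕ (Fin.suc j))) (λ ())
    (finalState A s₀) (finalState A (marked (suc j)))
    (R.trans (norm²-run (marked (suc j)) φ₀ Vs) (norm²-initial (U₀ A) (initial A)))
    (box≤ (solves s₀ 1 (longest-blank m)))
    (box≤ (solves (marked (suc j)) _ (longest-marked (suc j))))

  close : ∀ j → distance j ≤ℝ fromℚ q *ᴿ cost j
  close j = begin
    distance j
      -- Both runs start in the same state, so the accumulated error is 0. The weight nevertheless
      -- starts at 1, since it must be positive to be cancelled; hence T + 1 instead of T.
      ≲⟨ dist²-run 0 (marked (suc j)) s₀ 0ᴿ φ₀ φ₀ Vs
           (≤ℝ-reflexive (R.trans (dist²-self basis φ₀) (R.sym (R.zeroʳ (fromℚ (ι 1)))))) ⟩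
    fromℚ q *ᴿ (0ᴿ +ᴿ cost j)
      ≈⟨ R.*-congˡ {fromℚ q} (R.+-identityˡ (cost j)) ⟩
    fromℚ q *ᴿ cost j ∎

  0<q : 0ℚ ℚ.< q
  0<q = subst (λ k → 0ℚ ℚ.< ι k) (ℕ.+-comm 1 T) (0<ι T)

  bound : fromℚ (ι m) ≤ℝ fromℚ (18ℚ ℚ.* (q ℚ.* (ι T ℚ.* 4ℚ)))
  bound = begin
    fromℚ (ι m)
      ≈⟨ R.reflexive (cong (λ k → fromℚ (ι k)) (List.length-tabulate {n = m} (λ i → i))) ⟨
    fromℚ (ι (length (allFin m)))
      ≈⟨ ∑-1 (allFin m) ⟨
    ∑ᴿ (allFin m) (λ _ → 1ᴿ)
      ≲⟨ ∑-mono (allFin m) (λ j → begin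
           1ᴿ                                   ≲⟨ separated j ⟩
           fromℚ 18ℚ *ᴿ distance j              ≲⟨ *ᴿ-monoʳ-≤ 18ℚ (ℚ.positive⁻¹ 18ℚ) (close j) ⟩
           fromℚ 18ℚ *ᴿ (fromℚ q *ᴿ cost j)     ∎) ⟩
    ∑ᴿ (allFin m) (λ j → fromℚ 18ℚ *ᴿ (fromℚ q *ᴿ cost j))
      ≈⟨ ∑R.*-distribˡ-∑ (fromℚ 18ℚ) (allFin m) (λ j → fromℚ q *ᴿ cost j) ⟨
    fromℚ 18ℚ *ᴿ ∑ᴿ (allFin m) (λ j → fromℚ q *ᴿ cost j)
      ≈⟨ R.*-congˡ {fromℚ 18ℚ} (∑R.*-distribˡ-∑ (fromℚ q) (allFin m) cost) ⟨
    fromℚ 18ℚ *ᴿ (fromℚ q *ᴿ ∑ᴿ (allFin m) cost)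
      ≲⟨ *ᴿ-monoʳ-≤ 18ℚ (ℚ.positive⁻¹ 18ℚ) (*ᴿ-monoʳ-≤ q 0<q (∑-discrepancy φ₀ Vs)) ⟩
    fromℚ 18ℚ *ᴿ (fromℚ q *ᴿ (fromℚ (ι T) *ᴿ (fromℚ 4ℚ *ᴿ norm² basis φ₀)))
      ≈⟨ R.*-congˡ {fromℚ 18ℚ} (R.*-congˡ {fromℚ q} (R.*-congˡ {fromℚ (ι T)}
           (R.*-congˡ {fromℚ 4ℚ} (norm²-initial (U₀ A) (initial A))))) ⟩
    fromℚ 18ℚ *ᴿ (fromℚ q *ᴿ (fromℚ (ι T) *ᴿ (fromℚ 4ℚ *ᴿ 1ᴿ)))
      ≈⟨ pointwise (λ _ → refl) ⟩
    fromℚ (18ℚ ℚ.* (q ℚ.* (ι T ℚ.* 4ℚ)))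
      ∎

  ι-bound : ι (18 ℕ.* (suc T ℕ.* (T ℕ.* 4))) ≡ 18ℚ ℚ.* (q ℚ.* (ι T ℚ.* 4ℚ))
  ι-bound = ≡.trans (ι-* 18 (suc T ℕ.* (T ℕ.* 4))) (cong (18ℚ ℚ.*_)
    (≡.trans (ι-* (suc T) (T ℕ.* 4)) (cong₂ ℚ._*_ (cong ι (ℕ.+-comm 1 T)) (ι-* T 4))))

open import Data.Nat using (_≤_; _*_; _^_)

mainTheorem7 : ∃[ C ] ∃[ n₀ ] (1 ≤ C ×
    (∀ (σ b : ℕ) → 2 ≤ σ → σ ≤ 2 ^ b →
    ∀ (n : ℕ) → n₀ ≤ n →
    ∀ (T : ℕ) (A : Algorithm n b T) → SolvesLongestLyndon σ A →
    n ≤ (C * T) ^ 2))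
mainTheorem7 = 17 , 2 , s≤s z≤n , λ where
  _ b (s≤s (s≤s z≤n)) _ (suc m) (s≤s 1≤m) T A solves → quadratic⇒≤ m T 1≤m (query-bound A solves)
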